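{- Let $(X,d)$ be a Robinson space with PQ-tree $\mathcal T_{PQ}$. For any $p\in X$, let $\Upsilon(p)$ be the path of $\mathcal T_{PQ}$ between the leaf $p$ and the root (both included). Then the $p$-copoints are: (1) $X(\alpha)\setminus X(\beta)$ for each P-node $\alpha\in\Upsilon(p)$ with child $\beta\in\Upsilon(p)$; (2) $X(\beta)$ for each Q-node $\alpha\in\Upsilon(p)$ and each child $\beta\notin\Upsilon(p)$ of $\alpha$, when, if $\alpha$ is conical, $p$ is not in the apex child of $\alpha$; (3) $X(\alpha)\setminus X(\beta)$ for each $\delta$-conical Q-node $\alpha\in\Upsilon(p)$ with standard apex child $\beta\in\Upsilon(p)$, and $G_{\overline\delta}(X(\beta))$ is connected; (4) $X(\alpha)\setminus X(\gamma)$ for each $\delta$-conical Q-node $\alpha\in\Upsilon(p)$ with split child $\beta\in\Upsilon(p)$, and $\gamma\in\Upsilon(p)$ child of $\beta$.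
   Context: A dissimilarity on a finite set $X$ is a symmetric function $d:X^2\to\mathbb R_{\ge 0}$ with $d(x,y)=0$ if $x=y$. A total order $<$ on $X$ is compatible if $x<y<z$ implies $d(x,z)\ge\max\{d(x,y),d(y,z)\}$. $(X,d)$ is Robinson if it admits a compatible order. A PQ-tree over $X$ is an ordered rooted tree whose leaves are identified with the elements of $X$, whose inner nodes have at least 2 children and are each labelled P-node or Q-node; nodes with exactly 2 children are considered P-nodes. Two PQ-trees are equivalent if one is obtained from the other by a sequence of: arbitrarily permuting the children of a P-node; reversing the order of the children of a Q-node. The PQ-tree represents the set of left-to-right leaf orders of all equivalent PQ-trees. For a Robinson space, $\mathcal T_{PQ}$ is the PQ-tree (unique up to equivalence) representing exactly the set of compatible orders. $X(\alpha)$ is the set of leaves below node $\alpha$. An mmodule is a set $M\subseteq X$ such that $d(z,x)=d(z,y)$ for all $z\in X\setminus M$ and $x,y\in M$. A $p$-copoint is an inclusion-maximal mmodule among those not containing $p$. For $\delta>0$, $G_{\overline\delta}(S)$ is the graph on $S\subseteq X$ with edges $\{xy:x\ne y,\ d(x,y)\ne\delta\}$. A Q-node $\alpha$ with children $\beta_1,\dots,\beta_k$ is $\delta$-conical if it has a child $\beta_i$ (then unique, called the apex child) such that for all $j\ne i$, $d(x,y)=\delta$ for all $x\in X(\beta_i),y\in X(\beta_j)$; it is conical if it is $\delta$-conical for some $\delta>0$. A node $\alpha$ is split if it is the apex child of a $\delta$-conical Q-node and $G_{\overline\delta}(X(\alpha))$ is not connected; otherwise it is standard.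
   Formalization: In (1) the P-node α must be standard (for split α the claim fails); δ>0 is dropped from conical and split (it fails when distinct points have distance 0); copoints are nonempty (matters only if |X|=1); distances lie in any decidable total order above a least value 0. -}

module Defs where

open import Level using (Level; 0ℓ; _⊔_) renaming (suc to lsuc)
open import Data.Nat using (ℕ)
import Data.Nat as ℕ
open import Data.Fin using (Fin)
open import Data.Fin.Subset using (Subset; ⁅_⁆; ⋃; _∈_; _∉_; _⊆_; Nonempty)
open import Data.List using (List; []; _∷_; _++_; map; length; reverse; allFin)
import Data.List.Membership.Propositional as List
open import Data.List.Relation.Unary.All using (All)
open import Data.List.Relation.Binary.Permutation.Propositional using (_↭_)
import Data.List.Relation.Binary.Sublist.Propositional as Sublist
open import Data.Product using (∃; ∃₂; ∃-syntax; _×_)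
open import Function.Bundles using (_⇔_)
open import Relation.Nullary using (¬_)
open import Relation.Binary.Core using (Rel)
open import Relation.Binary.Bundles using (DecTotalOrder)
open import Relation.Binary.Structures using (IsStrictTotalOrder)
open import Relation.Binary.PropositionalEquality using (_≡_; _≢_)
open import Relation.Binary.Construct.Closure.ReflexiveTransitive using (Star)
import Algebra.Construct.NaturalChoice.Max as Max

------------------------------------------------------------------------
-- PQ-trees

data Kind : Set where
  P Q : Kind

data PQTree (A : Set) : Set where
  leaf : A → PQTree A
  node : Kind → List (PQTree A) → PQTree A

-- A node with exactly two children counts as a P-node, so a Q-node has
-- at least three.
minChildren : Kind → ℕ
minChildren P = 2
minChildren Q = 3

data WellFormed {A : Set} : PQTree A → Set where
  leaf : ∀ {x} → WellFormed (leaf x)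
  node : ∀ {k βs} → minChildren k ℕ.≤ length βs → All WellFormed βs →
         WellFormed (node k βs)

leaves : ∀ {A} → PQTree A → List A
forestLeaves : ∀ {A} → List (PQTree A) → List A
leaves (leaf x)    = x ∷ []
leaves (node _ βs) = forestLeaves βs
forestLeaves []       = []
forestLeaves (β ∷ βs) = leaves β ++ forestLeaves βs

record IsPQTree {n} (T : PQTree (Fin n)) : Set where
  field
    wellFormed : WellFormed T
    leaves↭X   : leaves T ↭ allFin n

infix 4 _⟶_ _~_

data _⟶_ {A : Set} : PQTree A → PQTree A → Set where
  permute : ∀ {βs γs} → βs ↭ γs → node P βs ⟶ node P γs
  flip    : ∀ {βs} → node Q βs ⟶ node Q (reverse βs)
  inside  : ∀ {k β γ} βs δs → β ⟶ γ →
            node k (βs ++ β ∷ δs) ⟶ node k (βs ++ γ ∷ δs)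

_~_ : ∀ {A} → PQTree A → PQTree A → Set
_~_ = Star _⟶_

-- A node of a tree is identified with the subtree hanging from it.  In a
-- tree satisfying IsPQTree this loses nothing: distinct nodes have distinct
-- leaf sets.
infix 4 _⊑_

data _⊑_ {A : Set} (α : PQTree A) : PQTree A → Set where
  here  : α ⊑ α
  below : ∀ {k β βs} → β List.∈ βs → α ⊑ β → α ⊑ node k βs

-- The nodes on the path from the leaf p to the root: the ancestors of p,
-- with p itself and the root included.
Υ : ∀ {A} → PQTree A → A → PQTree A → Set
Υ T p α = α ⊑ T × leaf p ⊑ α

X⟨_⟩ : ∀ {n} → PQTree (Fin n) → Subset n
X⟨ α ⟩ = ⋃ (map ⁅_⁆ (leaves α))

Precedes : ∀ {A : Set} → List A → A → A → Set
Precedes xs x y = (x ∷ y ∷ []) Sublist.⊆ xs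

------------------------------------------------------------------------
-- Robinson spaces

-- Distances are only ever compared with one another, so the nonnegative
-- reals are replaced by the elements above 0# in an arbitrary decidable
-- total order.
record Dissimilarity {c ℓ₁ ℓ₂} (V : DecTotalOrder c ℓ₁ ℓ₂)
                     (0# : DecTotalOrder.Carrier V) (n : ℕ) :
                     Set (c ⊔ ℓ₁ ⊔ ℓ₂) where
  open DecTotalOrder V using (Carrier; _≈_; _≤_)
  field
    d         : Fin n → Fin n → Carrier
    nonneg    : ∀ x y → 0# ≤ d x y
    symmetric : ∀ x y → d x y ≈ d y x
    diagonal  : ∀ x → d x x ≈ 0#

module _ {c ℓ₁ ℓ₂} {V : DecTotalOrder c ℓ₁ ℓ₂}
         {0# : DecTotalOrder.Carrier V} {n : ℕ}
         (D : Dissimilarity V 0# n) where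

  open DecTotalOrder V using (Carrier; _≈_; _≤_; totalOrder)
  open Max totalOrder using () renaming (_⊔_ to max)
  open Dissimilarity D using (d)

  Compatible : Rel (Fin n) 0ℓ → Set ℓ₂
  Compatible _<_ = ∀ {x y z} → x < y → y < z → max (d x y) (d y z) ≤ d x z

  Robinson : Set (lsuc 0ℓ ⊔ ℓ₂)
  Robinson = ∃ λ (_<_ : Rel (Fin n) 0ℓ) →
             IsStrictTotalOrder _≡_ _<_ × Compatible _<_

  RepresentsCompatibleOrders : PQTree (Fin n) → Set (lsuc 0ℓ ⊔ ℓ₂)
  RepresentsCompatibleOrders T =
    (_<_ : Rel (Fin n) 0ℓ) → IsStrictTotalOrder _≡_ _<_ →
    Compatible _<_ ⇔
      (∃[ T′ ] (T ~ T′ × (∀ x y → x < y ⇔ Precedes (leaves T′) x y)))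

  IsMmodule : Subset n → Set ℓ₁
  IsMmodule M = ∀ {z x y} → z ∉ M → x ∈ M → y ∈ M → d z x ≈ d z y

  -- Nonemptiness matters only for a one-point space, where ∅ would
  -- otherwise be a copoint; as soon as there is a point q ≠ p, the
  -- mmodule {q} prevents ∅ from being maximal.
  record IsCopoint (p : Fin n) (M : Subset n) : Set ℓ₁ where
    field
      mmodule  : IsMmodule M
      nonempty : Nonempty M
      avoids   : p ∉ M
      maximal  : ∀ {N} → IsMmodule N → p ∉ N → M ⊆ N → N ⊆ M

  Edge : Carrier → Subset n → Rel (Fin n) ℓ₁
  Edge δ S x y = x ∈ S × y ∈ S × x ≢ y × ¬ (d x y ≈ δ)

  Connected : Carrier → Subset n → Set ℓ₁
  Connected δ S = ∀ {x y} → x ∈ S → y ∈ S → Star (Edge δ S) x y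

  -- β is the apex child of the δ-conical Q-node with children βs.
  --
  -- The usual requirement δ > 0 is dropped.  It is automatic when distinct
  -- points are at nonzero distance; when zero distances are allowed, the
  -- description of the copoints fails with it: if d a u = d u b = 0 and
  -- d a b = 1, the tree is a Q-node with children a, u, b and the only
  -- u-copoint is {a, b}, so this node has to be conical with apex child u.
  IsApexChild : Carrier → List (PQTree (Fin n)) → PQTree (Fin n) → Set ℓ₁
  IsApexChild δ βs β =
    β List.∈ βs ×
    (∀ {γ} → γ List.∈ βs → γ ≢ β →
     ∀ {x y} → x ∈ X⟨ β ⟩ → y ∈ X⟨ γ ⟩ → d x y ≈ δ)

  Split : PQTree (Fin n) → PQTree (Fin n) → Set (c ⊔ ℓ₁)
  Split T α = ∃₂ λ δ βs →
    node Q βs ⊑ T × IsApexChild δ βs α × ¬ Connected δ X⟨ α ⟩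

  -- A P-node α ∋ p with child β ∋ p yields the copoint X⟨ α ⟩ ─ X⟨ β ⟩ only
  -- if α is standard: if α is split, that set lies strictly inside the
  -- copoint obtained from the conical parent of α.
  Standard : PQTree (Fin n) → PQTree (Fin n) → Set (c ⊔ ℓ₁)
  Standard T α = ¬ Split T α

{-# OPTIONS --safe #-}
module Submission where

-- Nodes are mmodules, because reversing a subtree in place keeps the order
-- compatible.  Conversely, since T represents all compatible orders, a
-- compatible order that no tree equivalent to T displays is a contradiction;
-- such orders come from reversing an interval that is an mmodule.  Applied to
-- the hull of an mmodule N meeting two children of a Q-node α, this shows that
-- the hull contains all of X(α).
-- Hence a node overlapped by an mmodule is split, and an mmodule that avoids
-- p ∈ X(β) but meets two children of the parent α of β forces β to be an apex
-- child; this gives the maximality of the listed sets.  Two p-copoints that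
-- meet are equal, because the union of two meeting mmodules is an mmodule, so
-- it remains to see that the listed sets cover X ∖ {p}: a point x ≠ p lies in
-- the set coming from the lowest common ancestor of p and x.

open import Defs
open import Data.Nat using (ℕ)
open import Data.Fin using (Fin)
open import Data.Fin.Subset using (Subset; _∈_; _─_)
open import Data.List.Membership.Propositional using () renaming (_∈_ to _∈ˡ_)
open import Data.Product using (∃-syntax; _×_)
open import Data.Sum using (_⊎_)
open import Function.Bundles using (_⇔_)
open import Relation.Nullary using (¬_)
open import Relation.Binary.Bundles using (DecTotalOrder)
open import Relation.Binary.PropositionalEquality using (_≡_)

open import Level using (0ℓ; _⊔_)
import Algebra.Construct.NaturalChoice.Max as Max
open import Data.Bool using (true; false)
open import Data.Empty using (⊥-elim)
open import Data.Fin.Properties using (_≟_; any?)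
open import Data.Fin.Subset using (⋃; ⁅_⁆; _∉_; _⊆_; _∪_)
open import Data.Fin.Subset.Properties
  using (_∈?_; x∈p∪q⁺; x∈p∪q⁻; x∈⁅x⁆; x∈⁅y⁆⇒x≡y; ∉⊥; p─q⊆p; x∈p∧x∉q⇒x∈p─q; ⊆-antisym)
open import Data.List using (List; []; _∷_; [_]; _++_; map; reverse)
import Data.List.Membership.DecPropositional as DecMembership
open import Data.List.Membership.Propositional using () renaming (_∉_ to _∉ˡ_)
open import Data.List.Membership.Propositional.Properties
  using (∈-++⁺ˡ; ∈-++⁺ʳ; ∈-++⁻; ∈-∃++; ∈-allFin)
open import Data.List.Properties using (++-assoc; ++-identityʳ; unfold-reverse; reverse-++)
open import Data.List.Relation.Binary.Permutation.Propositional
  using (_↭_; refl; prep; swap; ↭-refl; ↭-sym; ↭-trans; ↭-reflexive; ↭⇒↭ₛ)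
  renaming (trans to ↭-compose)
open import Data.List.Relation.Binary.Permutation.Propositional.Properties
  using (∈-resp-↭; ↭-reverse; ++⁺ʳ; ++⁺ˡ; shift)
  renaming (++-comm to ↭-++-comm; ++⁺ to ↭-++⁺)
import Data.List.Relation.Binary.Permutation.Setoid.Properties as ↭ₛ
open import Data.List.Relation.Binary.Sublist.Propositional using (_∷_; _∷ʳ_; from∈; to∈)
open import Data.List.Relation.Binary.Sublist.Propositional.Properties
  using ()
  renaming ( ++⁺ to ⊆-++⁺; ++⁺ˡ to ⊆-++⁺ˡ; ++⁺ʳ to ⊆-++⁺ʳ
           ; ∷ˡ⁻ to ⊆-∷ˡ⁻; reverse⁺ to ⊆-reverse⁺ )
import Data.List.Relation.Unary.All as All
open import Data.List.Relation.Unary.All using (_∷_)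
open import Data.List.Relation.Unary.AllPairs using ([]; _∷_)
open import Data.List.Relation.Unary.Any using (here; there)
open import Data.List.Relation.Unary.Unique.Propositional using (Unique)
open import Data.List.Relation.Unary.Unique.Propositional.Properties
  using (Unique[x∷xs]⇒x∉xs; allFin⁺)
open import Data.Nat using (s≤s)
open import Data.Product using (∃₂; _,_; proj₁; proj₂)
open import Data.Sum using (inj₁; inj₂; [_,_]′; map₁; map₂)
open import Data.Vec using (_∷_; here; there)
open import Function using (_∘_; id; case_of_)
open import Function.Bundles using (mk⇔; Equivalence)
open import Relation.Binary.Construct.Closure.ReflexiveTransitive
  using (Star; ε; _◅_; _◅◅_; gmap)
import Relation.Binary.Construct.Closure.ReflexiveTransitive as Star
open import Relation.Binary.Core using (Rel)
open import Relation.Binary.Definitions using (Trichotomous; tri<; tri≈; tri>)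
open import Relation.Binary.PropositionalEquality
  using ( _≢_; refl; sym; trans; cong; cong₂; subst; subst₂; isEquivalence; resp₂; setoid
        ; module ≡-Reasoning )
open import Relation.Binary.Structures using (IsStrictTotalOrder)
open import Relation.Nullary using (Dec; yes; no; ¬?; _×-dec_; _⊎-dec_; contradiction)
open import Relation.Unary using (Pred; Decidable)

-- An mmodule need not be an interval of a leaf order, and only intervals can be reversed. Its hull
-- is again an mmodule, since a point outside the hull sees all of it from one side; so the hull is
-- what gets reversed. This says nothing about P-nodes, where the tool is instead to move one child
-- to an end. The constant of a conical node is forced. If `N` overlaps `β`, with `a` in `β` but not
-- in `N`, and `c` in `N` but not in `β`, then `δ = d a c` is the distance from every point of `β`
-- outside `N` to every point of `N`. It is at once the diameter of `β` and the distance from `β` to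
-- the leaves of its siblings. That `δ` bounds the diameter matters: in a compatible order the graph
-- of distances other than `δ` is then either connected through consecutive leaves or cut into two
-- consecutive blocks, and blocks are again intervals. The blocks of a cut Q-node would be mmodules,
-- one of them meeting two children, which the hull forbids. So split nodes are P-nodes and their
-- children are standard, which is why the fourth family descends exactly one level below the apex
-- child.

x∈p─q⇒x∉q : ∀ {n} (p q : Subset n) {x} → x ∈ p ─ q → x ∉ q
x∈p─q⇒x∉q (true ∷ _)  (false ∷ _) here       ()
x∈p─q⇒x∉q (_ ∷ p)     (false ∷ q) (there x∈) (there x∈q) = x∈p─q⇒x∉q p q x∈ x∈q
x∈p─q⇒x∉q (_ ∷ p)     (true ∷ q)  (there x∈) (there x∈q) = x∈p─q⇒x∉q p q x∈ x∈q

-- Precedence in duplicate-free lists.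

module _ {A : Set} where

  unique-++⁻ˡ : ∀ (xs : List A) {ys} → Unique (xs ++ ys) → Unique xs
  unique-++⁻ˡ []       u       = []
  unique-++⁻ˡ (x ∷ xs) (p ∷ u) =
    All.tabulate (λ q → All.lookup p (∈-++⁺ˡ q)) ∷ unique-++⁻ˡ xs u

  unique-++⁻ʳ : ∀ (xs : List A) {ys} → Unique (xs ++ ys) → Unique ys
  unique-++⁻ʳ []       u       = u
  unique-++⁻ʳ (x ∷ xs) (_ ∷ u) = unique-++⁻ʳ xs u

  precedes-∈ˡ : ∀ {xs} {x y : A} → Precedes xs x y → x ∈ˡ xs
  precedes-∈ˡ (_ ∷ʳ p)   = there (precedes-∈ˡ p)
  precedes-∈ˡ (refl ∷ p) = here refl

  precedes-∈ʳ : ∀ {xs} {x y : A} → Precedes xs x y → y ∈ˡ xs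
  precedes-∈ʳ (_ ∷ʳ p)   = there (precedes-∈ʳ p)
  precedes-∈ʳ (refl ∷ p) = there (to∈ p)

  precedes-irrefl : ∀ {xs} {x : A} → Unique xs → ¬ Precedes xs x x
  precedes-irrefl (_ ∷ u) (_ ∷ʳ p)   = precedes-irrefl u p
  precedes-irrefl u       (refl ∷ p) = Unique[x∷xs]⇒x∉xs u (to∈ p)

  precedes-trans : ∀ {xs} {x y z : A} → Unique xs →
                   Precedes xs x y → Precedes xs y z → Precedes xs x z
  precedes-trans (_ ∷ u) (_ ∷ʳ p)   (_ ∷ʳ q)   = _ ∷ʳ precedes-trans u p q
  precedes-trans u       (_ ∷ʳ p)   (refl ∷ q) =
    contradiction (precedes-∈ʳ p) (Unique[x∷xs]⇒x∉xs u)
  precedes-trans u       (refl ∷ p) (_ ∷ʳ q)   = refl ∷ ⊆-∷ˡ⁻ q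
  precedes-trans u       (refl ∷ p) (refl ∷ q) = refl ∷ q

  precedes-asym : ∀ {xs} {x y : A} → Unique xs → Precedes xs x y → ¬ Precedes xs y x
  precedes-asym u p q = precedes-irrefl u (precedes-trans u p q)

  precedes-total : ∀ {xs} {x y : A} → x ∈ˡ xs → y ∈ˡ xs → x ≢ y →
                   Precedes xs x y ⊎ Precedes xs y x
  precedes-total (here refl) (here refl) x≢y = contradiction refl x≢y
  precedes-total (here refl) (there q)   _   = inj₁ (refl ∷ from∈ q)
  precedes-total (there p)   (here refl) _   = inj₂ (refl ∷ from∈ p)
  precedes-total (there p)   (there q)   x≢y =
    [ inj₁ ∘ (_ ∷ʳ_) , inj₂ ∘ (_ ∷ʳ_) ]′ (precedes-total p q x≢y)

  precedes-++ : ∀ {xs ys} {x y : A} → x ∈ˡ xs → y ∈ˡ ys → Precedes (xs ++ ys) x y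
  precedes-++ p q = ⊆-++⁺ (from∈ p) (from∈ q)

  precedes-infix : ∀ (us vs ws : List A) {x y} → Unique (us ++ vs ++ ws) →
                   x ∈ˡ vs → y ∈ˡ vs → Precedes (us ++ vs ++ ws) x y → Precedes vs x y
  precedes-infix us vs ws u x∈ y∈ p
    with precedes-total x∈ y∈ (λ { refl → precedes-irrefl u p })
  ... | inj₁ q = q
  ... | inj₂ q = contradiction (⊆-++⁺ˡ us (⊆-++⁺ʳ ws q)) (precedes-asym u p)

  infix-convex : ∀ (us vs ws : List A) {x y z} → Unique (us ++ vs ++ ws) →
                 x ∈ˡ vs → z ∈ˡ vs →
                 Precedes (us ++ vs ++ ws) x y → Precedes (us ++ vs ++ ws) y z →
                 y ∈ˡ vs
  infix-convex us vs ws u x∈ z∈ p q with ∈-++⁻ us (precedes-∈ʳ p)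
  ... | inj₁ y∈ = contradiction (precedes-++ y∈ (∈-++⁺ˡ x∈)) (precedes-asym u p)
  ... | inj₂ y∈ with ∈-++⁻ vs y∈
  ...   | inj₁ y∈vs = y∈vs
  ...   | inj₂ y∈ws =
    contradiction (⊆-++⁺ˡ us (precedes-++ z∈ y∈ws)) (precedes-asym u q)

  -- Leaf sequences, subtrees and equivalence of trees.

  forestLeaves-++ : ∀ (βs γs : List (PQTree A)) →
                    forestLeaves (βs ++ γs) ≡ forestLeaves βs ++ forestLeaves γs
  forestLeaves-++ []       γs = refl
  forestLeaves-++ (β ∷ βs) γs =
    trans (cong (leaves β ++_) (forestLeaves-++ βs γs))
          (sym (++-assoc (leaves β) (forestLeaves βs) (forestLeaves γs)))

  child-leaf : ∀ {βs β} {x : A} → β ∈ˡ βs → x ∈ˡ leaves β → x ∈ˡ forestLeaves βs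
  child-leaf (here refl)        x∈ = ∈-++⁺ˡ x∈
  child-leaf (there {x = γ} β∈) x∈ = ∈-++⁺ʳ (leaves γ) (child-leaf β∈ x∈)

  childOf : ∀ βs {x : A} → x ∈ˡ forestLeaves βs → ∃[ β ] (β ∈ˡ βs × x ∈ˡ leaves β)
  childOf (β ∷ βs) x∈ with ∈-++⁻ (leaves β) x∈
  ... | inj₁ x∈β = β , here refl , x∈β
  ... | inj₂ x∈βs = let γ , γ∈ , x∈γ = childOf βs x∈βs in γ , there γ∈ , x∈γ

  forestLeaves-infix : ∀ {βs β} → β ∈ˡ βs →
    ∃₂ λ us ws → forestLeaves {A} βs ≡ us ++ leaves β ++ ws
  forestLeaves-infix {β ∷ βs} (here refl) = [] , forestLeaves βs , refl
  forestLeaves-infix {γ ∷ βs} {β} (there β∈) =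
    let us , ws , eq = forestLeaves-infix β∈ in
    leaves γ ++ us , ws ,
    trans (cong (leaves γ ++_) eq) (sym (++-assoc (leaves γ) us (leaves β ++ ws)))

  children-disjoint : ∀ {βs β γ} {x : A} → Unique (forestLeaves βs) →
                      β ∈ˡ βs → γ ∈ˡ βs → x ∈ˡ leaves β → x ∈ˡ leaves γ → β ≡ γ
  children-disjoint u (here refl) (here refl) _ _ = refl
  children-disjoint u (here refl) (there γ∈) x∈β x∈γ =
    contradiction (precedes-++ x∈β (child-leaf γ∈ x∈γ)) (precedes-irrefl u)
  children-disjoint u (there β∈) (here refl) x∈β x∈γ =
    contradiction (precedes-++ x∈γ (child-leaf β∈ x∈β)) (precedes-irrefl u)
  children-disjoint {δ ∷ _} u (there β∈) (there γ∈) x∈β x∈γ =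
    children-disjoint (unique-++⁻ʳ (leaves δ) u) β∈ γ∈ x∈β x∈γ

  forestLeaves-↭ : ∀ {βs γs : List (PQTree A)} → βs ↭ γs → forestLeaves βs ↭ forestLeaves γs
  forestLeaves-↭ refl        = refl
  forestLeaves-↭ (prep β p)  = ++⁺ˡ (leaves β) (forestLeaves-↭ p)
  forestLeaves-↭ {_ ∷ _ ∷ βs} {_ ∷ _ ∷ γs} (swap β γ p) =
    ↭-trans (↭-reflexive (sym (++-assoc (leaves β) (leaves γ) _)))
      (↭-trans (↭-++⁺ (↭-++-comm (leaves β) (leaves γ)) (forestLeaves-↭ p))
               (↭-reflexive (++-assoc (leaves γ) (leaves β) _)))
  forestLeaves-↭ (↭-compose p q) = ↭-trans (forestLeaves-↭ p) (forestLeaves-↭ q)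

  leaves-⟶ : ∀ {β γ : PQTree A} → β ⟶ γ → leaves β ↭ leaves γ
  leaves-⟶ (permute p)       = forestLeaves-↭ p
  leaves-⟶ (flip {βs})       = forestLeaves-↭ (↭-sym (↭-reverse βs))
  leaves-⟶ (inside {β = β} {γ} βs δs s) =
    ↭-trans (↭-reflexive (forestLeaves-++ βs (β ∷ δs)))
      (↭-trans (++⁺ˡ (forestLeaves βs) (++⁺ʳ (forestLeaves δs) (leaves-⟶ s)))
               (↭-reflexive (sym (forestLeaves-++ βs (γ ∷ δs)))))

  leaves-~ : ∀ {β γ : PQTree A} → β ~ γ → leaves β ↭ leaves γ
  leaves-~ ε       = ↭-refl
  leaves-~ (s ◅ r) = ↭-trans (leaves-⟶ s) (leaves-~ r)

  ⊑-leaves : ∀ {α β} {x : A} → α ⊑ β → x ∈ˡ leaves α → x ∈ˡ leaves β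
  ⊑-leaves here         x∈ = x∈
  ⊑-leaves (below β∈ p) x∈ = child-leaf β∈ (⊑-leaves p x∈)

  leaf⇒∈ : ∀ {α} {x : A} → leaf x ⊑ α → x ∈ˡ leaves α
  leaf⇒∈ p = ⊑-leaves p (here refl)

  ∈⇒leaf : ∀ α {x : A} → x ∈ˡ leaves α → leaf x ⊑ α
  ∈⇒leaf-forest : ∀ k βs {x : A} → x ∈ˡ forestLeaves βs → leaf x ⊑ node k βs
  ∈⇒leaf (leaf y) (here refl) = here
  ∈⇒leaf (node k βs) x∈ = ∈⇒leaf-forest k βs x∈
  ∈⇒leaf-forest k (β ∷ βs) x∈ with ∈-++⁻ (leaves β) x∈
  ... | inj₁ x∈β  = below (here refl) (∈⇒leaf β x∈β)
  ... | inj₂ x∈βs with ∈⇒leaf-forest k βs x∈βs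
  ...   | below γ∈ p = below (there γ∈) p

  ⊑-trans : ∀ {α β γ : PQTree A} → α ⊑ β → β ⊑ γ → α ⊑ γ
  ⊑-trans p here         = p
  ⊑-trans p (below γ∈ q) = below γ∈ (⊑-trans p q)

  child-⊑ : ∀ {k βs β} {T : PQTree A} → node k βs ⊑ T → β ∈ˡ βs → β ⊑ T
  child-⊑ p β∈ = ⊑-trans (below β∈ here) p

  ⊑-infix : ∀ {α T : PQTree A} → α ⊑ T → ∃₂ λ us ws → leaves T ≡ us ++ leaves α ++ ws
  ⊑-infix here = [] , [] , sym (++-identityʳ _)
  ⊑-infix {α} (below β∈ p) with ⊑-infix p | forestLeaves-infix β∈
  ... | us , ws , eq | us′ , ws′ , eq′ = us′ ++ us , ws ++ ws′ , (begin
      _                                       ≡⟨ eq′ ⟩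
      us′ ++ _ ++ ws′                         ≡⟨ cong (λ l → us′ ++ l ++ ws′) eq ⟩
      us′ ++ (us ++ leaves α ++ ws) ++ ws′    ≡⟨ cong (us′ ++_) (++-assoc us _ ws′) ⟩
      us′ ++ us ++ (leaves α ++ ws) ++ ws′    ≡⟨ cong (λ l → us′ ++ us ++ l)
                                                        (++-assoc (leaves α) ws ws′) ⟩
      us′ ++ us ++ leaves α ++ ws ++ ws′      ≡⟨ sym (++-assoc us′ us _) ⟩
      (us′ ++ us) ++ leaves α ++ ws ++ ws′    ∎)
    where open ≡-Reasoning

  ⊑-unique : ∀ {α T : PQTree A} → α ⊑ T → Unique (leaves T) → Unique (leaves α)
  ⊑-unique {α} p u with ⊑-infix p
  ... | us , ws , eq =
    unique-++⁻ˡ (leaves α) (unique-++⁻ʳ us (subst Unique eq u))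

  -- The context `us`, `ws` is fixed before `α′` is chosen, so two rewritings of the same node share
  -- their surroundings and the resulting leaf orders can be compared.
  replace : ∀ {α T : PQTree A} → α ⊑ T →
    ∃₂ λ us ws → ∀ {α′} → α ~ α′ → ∃[ T′ ] (T ~ T′ × leaves T′ ≡ us ++ leaves α′ ++ ws)
  replace here = [] , [] , λ r → _ , r , sym (++-identityʳ _)
  replace {α} {node k _} (below {β = β} β∈ p) with replace p | ∈-∃++ β∈
  ... | us , ws , f | βs , δs , refl =
    forestLeaves βs ++ us , ws ++ forestLeaves δs , λ {α′} r →
      let β′ , s , eq = f r in
      node k (βs ++ β′ ∷ δs) , gmap (λ γ → node k (βs ++ γ ∷ δs)) (inside βs δs) s ,
      (begin
        forestLeaves (βs ++ β′ ∷ δs)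
          ≡⟨ forestLeaves-++ βs (β′ ∷ δs) ⟩
        forestLeaves βs ++ leaves β′ ++ forestLeaves δs
          ≡⟨ cong (λ l → forestLeaves βs ++ l ++ forestLeaves δs) eq ⟩
        forestLeaves βs ++ (us ++ leaves α′ ++ ws) ++ forestLeaves δs
          ≡⟨ cong (forestLeaves βs ++_) (++-assoc us _ _) ⟩
        forestLeaves βs ++ us ++ (leaves α′ ++ ws) ++ forestLeaves δs
          ≡⟨ cong (λ l → forestLeaves βs ++ us ++ l) (++-assoc (leaves α′) ws _) ⟩
        forestLeaves βs ++ us ++ leaves α′ ++ ws ++ forestLeaves δs
          ≡⟨ sym (++-assoc (forestLeaves βs) us _) ⟩
        (forestLeaves βs ++ us) ++ leaves α′ ++ ws ++ forestLeaves δs ∎)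
    where open ≡-Reasoning

  reverse-children : ∀ k βs → node {A} k βs ~ node k (reverse βs)
  reverse-children P βs = permute (↭-sym (↭-reverse βs)) ◅ ε
  reverse-children Q βs = flip ◅ ε

  -- Both kinds of node admit reversal of their children, so reversing at every level reverses the
  -- whole leaf sequence. In a forest the children are first mirrored in place, the prefix `δs`
  -- holding those already treated; their order is reversed only at the end.
  mirror : ∀ (α : PQTree A) → ∃[ α′ ] (α ~ α′ × leaves α′ ≡ reverse (leaves α))
  mirror-forest : ∀ βs → ∃[ γs ]
    ((∀ k δs → node {A} k (δs ++ βs) ~ node k (δs ++ γs)) ×
     forestLeaves (reverse γs) ≡ reverse (forestLeaves βs))
  mirror (leaf x)    = leaf x , ε , refl
  mirror (node k βs) =
    let γs , r , eq = mirror-forest βs in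
    node k (reverse γs) , r k [] ◅◅ reverse-children k γs , eq
  mirror-forest []       = [] , (λ _ _ → ε) , refl
  mirror-forest (β ∷ βs) =
    let γ , s , eq = mirror β
        γs , r , eqs = mirror-forest βs
    in γ ∷ γs ,
       (λ k δs → gmap (λ α → node k (δs ++ α ∷ βs)) (inside δs βs) s ◅◅
         subst₂ (λ l m → node k l ~ node k m)
                (++-assoc δs [ γ ] βs) (++-assoc δs [ γ ] γs) (r k (δs ++ [ γ ]))) ,
       (begin
         forestLeaves (reverse (γ ∷ γs))
           ≡⟨ cong forestLeaves (unfold-reverse γ γs) ⟩
         forestLeaves (reverse γs ++ [ γ ])
           ≡⟨ forestLeaves-++ (reverse γs) [ γ ] ⟩
         forestLeaves (reverse γs) ++ leaves γ ++ []
           ≡⟨ cong₂ _++_ eqs (trans (++-identityʳ _) eq) ⟩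
         reverse (forestLeaves βs) ++ reverse (leaves β)
           ≡⟨ sym (reverse-++ (leaves β) (forestLeaves βs)) ⟩
         reverse (leaves β ++ forestLeaves βs) ∎)
    where open ≡-Reasoning

  -- Betweenness excluded by the tree.

  -- A comparison of positions in the list of children: rewriting inside a child cannot disturb it,
  -- and `flip` reverses it.
  data Before (x y : A) : List (PQTree A) → Set where
    first : ∀ {β βs} → x ∈ˡ leaves β → y ∈ˡ forestLeaves βs → Before x y (β ∷ βs)
    later : ∀ {β βs} → Before x y βs → Before x y (β ∷ βs)

  before⇒precedes : ∀ {x y βs} → Before x y βs → Precedes (forestLeaves βs) x y
  before⇒precedes (first x∈ y∈)      = precedes-++ x∈ y∈
  before⇒precedes (later {β = β} b) = ⊆-++⁺ˡ (leaves β) (before⇒precedes b)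

  before-total : ∀ {x y βs β γ} → β ∈ˡ βs → γ ∈ˡ βs → x ∈ˡ leaves β → y ∈ˡ leaves γ →
                 β ≢ γ → Before x y βs ⊎ Before y x βs
  before-total (here refl) (here refl) _  _  β≢γ = contradiction refl β≢γ
  before-total (here refl) (there γ∈)  x∈ y∈ _   = inj₁ (first x∈ (child-leaf γ∈ y∈))
  before-total (there β∈)  (here refl) x∈ y∈ _   = inj₂ (first y∈ (child-leaf β∈ x∈))
  before-total (there β∈)  (there γ∈)  x∈ y∈ β≢γ =
    [ inj₁ ∘ later , inj₂ ∘ later ]′ (before-total β∈ γ∈ x∈ y∈ β≢γ)

  before-++ : ∀ {x y} βs {γs} → x ∈ˡ forestLeaves βs → y ∈ˡ forestLeaves γs →
              Before x y (βs ++ γs)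
  before-++ (β ∷ βs) {γs} x∈ y∈ with ∈-++⁻ (leaves β) x∈
  ... | inj₁ x∈β  = first x∈β (subst (_ ∈ˡ_) (sym (forestLeaves-++ βs γs))
                                     (∈-++⁺ʳ (forestLeaves βs) y∈))
  ... | inj₂ x∈βs = later (before-++ βs x∈βs y∈)

  before-++ˡ : ∀ {x y βs} γs → Before x y βs → Before x y (βs ++ γs)
  before-++ˡ {βs = _ ∷ βs} γs (first x∈ y∈) =
    first x∈ (subst (_ ∈ˡ_) (sym (forestLeaves-++ βs γs)) (∈-++⁺ˡ y∈))
  before-++ˡ γs (later b) = later (before-++ˡ γs b)

  before-reverse : ∀ {x y βs} → Before x y βs → Before y x (reverse βs)
  before-reverse {x} {y} {β ∷ βs} b = subst (Before y x) (sym (unfold-reverse β βs)) (case b)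
    where
    case : Before x y (β ∷ βs) → Before y x (reverse βs ++ [ β ])
    case (first x∈ y∈) = before-++ (reverse βs)
      (∈-resp-↭ (forestLeaves-↭ (↭-sym (↭-reverse βs))) y∈) (∈-++⁺ˡ x∈)
    case (later b)     = before-++ˡ [ β ] (before-reverse b)

  before-inside : ∀ {x y} βs {β γ δs} → leaves β ↭ leaves γ →
                  Before x y (βs ++ β ∷ δs) → Before x y (βs ++ γ ∷ δs)
  before-inside []       r (first x∈ y∈) = first (∈-resp-↭ r x∈) y∈
  before-inside []       r (later b)     = later b
  before-inside (_ ∷ βs) {β} {γ} {δs} r (first x∈ y∈) = first x∈
    (∈-resp-↭ (↭-trans (↭-reflexive (forestLeaves-++ βs (β ∷ δs)))
      (↭-trans (++⁺ˡ (forestLeaves βs) (++⁺ʳ (forestLeaves δs) r))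
        (↭-reflexive (sym (forestLeaves-++ βs (γ ∷ δs)))))) y∈)
  before-inside (_ ∷ βs) r (later b)     = later (before-inside βs r b)

  -- The reasons for which no tree equivalent to the given one displays y
  -- between x and z.
  data NeverBetween (y x z : A) : PQTree A → Set where
    descend : ∀ {k βs β} → β ∈ˡ βs → NeverBetween y x z β → NeverBetween y x z (node k βs)
    aside   : ∀ {k βs β} → β ∈ˡ βs → x ∈ˡ leaves β → z ∈ˡ leaves β → y ∉ˡ leaves β →
              y ∈ˡ forestLeaves βs → NeverBetween y x z (node k βs)
    left    : ∀ {βs} → Before y x βs → Before y z βs → NeverBetween y x z (node Q βs)
    right   : ∀ {βs} → Before x y βs → Before z y βs → NeverBetween y x z (node Q βs)

  neverBetween-leaves : ∀ {y x z T} → NeverBetween y x z T →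
    y ∈ˡ leaves T × x ∈ˡ leaves T × z ∈ˡ leaves T
  neverBetween-leaves (descend β∈ s) =
    let y∈ , x∈ , z∈ = neverBetween-leaves s
    in child-leaf β∈ y∈ , child-leaf β∈ x∈ , child-leaf β∈ z∈
  neverBetween-leaves (aside β∈ x∈ z∈ _ y∈) = y∈ , child-leaf β∈ x∈ , child-leaf β∈ z∈
  neverBetween-leaves (left b c) =
    precedes-∈ˡ (before⇒precedes b) , precedes-∈ʳ (before⇒precedes b) ,
    precedes-∈ʳ (before⇒precedes c)
  neverBetween-leaves (right b c) =
    precedes-∈ʳ (before⇒precedes b) , precedes-∈ˡ (before⇒precedes b) ,
    precedes-∈ˡ (before⇒precedes c)

  neverBetween-sound : ∀ {y x z T} → Unique (leaves T) → NeverBetween y x z T →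
    Precedes (leaves T) x y → ¬ Precedes (leaves T) y z
  neverBetween-sound u (descend {β = β} β∈ s) p q with forestLeaves-infix β∈
  ... | us , ws , eq =
    let y∈ , x∈ , z∈ = neverBetween-leaves s
        u′ = subst Unique eq u
    in neverBetween-sound (unique-++⁻ˡ (leaves β) (unique-++⁻ʳ us u′)) s
         (precedes-infix us _ ws u′ x∈ y∈ (subst (λ l → Precedes l _ _) eq p))
         (precedes-infix us _ ws u′ y∈ z∈ (subst (λ l → Precedes l _ _) eq q))
  neverBetween-sound u (aside β∈ x∈ z∈ y∉ _) p q with forestLeaves-infix β∈
  ... | us , ws , eq = y∉ (infix-convex us _ ws (subst Unique eq u) x∈ z∈
    (subst (λ l → Precedes l _ _) eq p) (subst (λ l → Precedes l _ _) eq q))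
  neverBetween-sound u (left b c)  p q = precedes-asym u p (before⇒precedes b)
  neverBetween-sound u (right b c) p q = precedes-asym u q (before⇒precedes c)

  -- `aside` speaks only of the leaf sets of a node and its child, which the moves preserve. `left`
  -- and `right` speak of the order of the children, which at a Q-node can only be reversed,
  -- exchanging the two.
  neverBetween-⟶ : ∀ {y x z T T′} → T ⟶ T′ → NeverBetween y x z T → NeverBetween y x z T′
  neverBetween-⟶ (permute p) (descend β∈ s) = descend (∈-resp-↭ p β∈) s
  neverBetween-⟶ (permute p) (aside β∈ x∈ z∈ y∉ y∈) =
    aside (∈-resp-↭ p β∈) x∈ z∈ y∉ (∈-resp-↭ (forestLeaves-↭ p) y∈)
  neverBetween-⟶ (flip {βs}) (descend β∈ s) = descend (∈-resp-↭ (↭-sym (↭-reverse βs)) β∈) s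
  neverBetween-⟶ (flip {βs}) (aside β∈ x∈ z∈ y∉ y∈) =
    aside (∈-resp-↭ (↭-sym (↭-reverse βs)) β∈) x∈ z∈ y∉ (∈-resp-↭ (leaves-⟶ (flip {βs = βs})) y∈)
  neverBetween-⟶ flip (left b c)  = right (before-reverse b) (before-reverse c)
  neverBetween-⟶ flip (right b c) = left (before-reverse b) (before-reverse c)
  neverBetween-⟶ (inside βs δs r) (descend β∈ s) with ∈-++⁻ βs β∈
  ... | inj₁ β∈βs         = descend (∈-++⁺ˡ β∈βs) s
  ... | inj₂ (here refl)  = descend (∈-++⁺ʳ βs (here refl)) (neverBetween-⟶ r s)
  ... | inj₂ (there β∈δs) = descend (∈-++⁺ʳ βs (there β∈δs)) s
  neverBetween-⟶ {T′ = T′} (inside {k} βs δs r) (aside {β = β} β∈ x∈ z∈ y∉ y∈) = locate (∈-++⁻ βs β∈)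
    where
    y∈′ = ∈-resp-↭ (leaves-⟶ (inside {k = k} βs δs r)) y∈
    locate : β ∈ˡ βs ⊎ β ∈ˡ _ ∷ δs → NeverBetween _ _ _ T′
    locate (inj₁ β∈βs)         = aside (∈-++⁺ˡ β∈βs) x∈ z∈ y∉ y∈′
    locate (inj₂ (here refl))  =
      aside (∈-++⁺ʳ βs (here refl)) (∈-resp-↭ (leaves-⟶ r) x∈) (∈-resp-↭ (leaves-⟶ r) z∈)
            (y∉ ∘ ∈-resp-↭ (↭-sym (leaves-⟶ r))) y∈′
    locate (inj₂ (there β∈δs)) = aside (∈-++⁺ʳ βs (there β∈δs)) x∈ z∈ y∉ y∈′
  neverBetween-⟶ (inside βs δs r) (left b c)  =
    left (before-inside βs (leaves-⟶ r) b) (before-inside βs (leaves-⟶ r) c)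
  neverBetween-⟶ (inside βs δs r) (right b c) =
    right (before-inside βs (leaves-⟶ r) b) (before-inside βs (leaves-⟶ r) c)

  neverBetween-~ : ∀ {y x z T T′} → T ~ T′ → NeverBetween y x z T → NeverBetween y x z T′
  neverBetween-~ ε       s = s
  neverBetween-~ (r ◅ t) s = neverBetween-~ t (neverBetween-⟶ r s)

  neverBetween-⊑ : ∀ {y x z α T} → α ⊑ T → NeverBetween y x z α → NeverBetween y x z T
  neverBetween-⊑ here         s = s
  neverBetween-⊑ (below β∈ p) s = descend β∈ (neverBetween-⊑ p s)

  unique-resp-↭ : {xs ys : List A} → xs ↭ ys → Unique xs → Unique ys
  unique-resp-↭ p = ↭ₛ.Unique-resp-↭ (setoid A) (↭⇒↭ₛ p)

  -- Leaves in different children.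

  Apart : List (PQTree A) → A → A → Set
  Apart βs x y = ∀ {β} → β ∈ˡ βs → x ∈ˡ leaves β → y ∉ˡ leaves β

  apart-sym : ∀ {βs x y} → Apart βs x y → Apart βs y x
  apart-sym a β∈ y∈ x∈ = a β∈ x∈ y∈

  ∉⇒apart : ∀ {βs β x y} → Unique (forestLeaves βs) → β ∈ˡ βs → x ∈ˡ leaves β →
            y ∉ˡ leaves β → Apart βs x y
  ∉⇒apart u β∈ x∈ y∉ γ∈ x∈γ y∈γ with children-disjoint u β∈ γ∈ x∈ x∈γ
  ... | refl = y∉ y∈γ

  apart⇒before : ∀ {βs x y} → Unique (forestLeaves βs) → Apart βs x y →
                 Precedes (forestLeaves βs) x y → Before x y βs
  apart⇒before {βs} u a p =
    let β , β∈ , x∈ = childOf βs (precedes-∈ˡ p)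
        γ , γ∈ , y∈ = childOf βs (precedes-∈ʳ p)
    in [ id , (λ b → contradiction (before⇒precedes b) (precedes-asym u p)) ]′
         (before-total β∈ γ∈ x∈ y∈
           (λ eq → a β∈ x∈ (subst (λ δ → _ ∈ˡ leaves δ) (sym eq) y∈)))

  wellFormed-⊑ : ∀ {α T : PQTree A} → α ⊑ T → WellFormed T → WellFormed α
  wellFormed-⊑ here         w          = w
  wellFormed-⊑ (below β∈ p) (node _ ws) = wellFormed-⊑ p (All.lookup ws β∈)

  someLeaf : ∀ {α : PQTree A} → WellFormed α → ∃[ x ] x ∈ˡ leaves α
  someLeaf (leaf {x})                           = x , here refl
  someLeaf (node {P} {[]} () _)
  someLeaf (node {Q} {[]} () _)
  someLeaf (node {_} {_ ∷ _} _ (w ∷ _)) =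
    let x , x∈ = someLeaf w in x , ∈-++⁺ˡ x∈

  headLeaf-apart : ∀ {β : PQTree A} {βs x y} → Unique (forestLeaves (β ∷ βs)) →
                   x ∈ˡ leaves β → y ∈ˡ forestLeaves βs → Apart (β ∷ βs) x y
  headLeaf-apart {β} u x∈ y∈ = ∉⇒apart u (here refl) x∈
    (λ y∈β → precedes-irrefl u (precedes-++ y∈β y∈))

  twoApart : ∀ {k βs} → WellFormed (node k βs) → Unique (forestLeaves βs) →
    ∃₂ λ x y → x ∈ˡ forestLeaves βs × y ∈ˡ forestLeaves βs × Apart βs x y
  twoApart (node {P} {[]} () _)
  twoApart (node {P} {_ ∷ []} (s≤s ()) _)
  twoApart (node {Q} {[]} () _)
  twoApart (node {Q} {_ ∷ []} (s≤s ()) _)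
  twoApart (node {_} {β ∷ γ ∷ _} _ (v ∷ w ∷ _)) u =
    let x , x∈ = someLeaf v
        y , y∈ = someLeaf w
        y∈βs   = ∈-++⁺ˡ y∈
    in x , y , ∈-++⁺ˡ x∈ , ∈-++⁺ʳ (leaves β) y∈βs , headLeaf-apart u x∈ y∈βs

  threeApart : ∀ {βs} → WellFormed (node Q βs) → Unique (forestLeaves βs) →
    ∃[ x ] ∃[ y ] ∃[ z ]
      (x ∈ˡ forestLeaves βs × y ∈ˡ forestLeaves βs × z ∈ˡ forestLeaves βs ×
       Apart βs x y × Apart βs y z × Apart βs x z)
  threeApart (node {Q} {[]} () _)
  threeApart (node {Q} {_ ∷ []} (s≤s ()) _)
  threeApart (node {Q} {_ ∷ _ ∷ []} (s≤s (s≤s ())) _)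
  threeApart (node {Q} {β ∷ γ ∷ δ ∷ _} _ (wβ ∷ wγ ∷ wδ ∷ _)) u =
    let x , x∈ = someLeaf wβ
        y , y∈ = someLeaf wγ
        z , z∈ = someLeaf wδ
        y∈βs   = ∈-++⁺ˡ y∈
        z∈γs   = ∈-++⁺ˡ z∈
        z∈βs   = ∈-++⁺ʳ (leaves γ) z∈γs
        u′     = unique-++⁻ʳ (leaves β) u
    in x , y , z , ∈-++⁺ˡ x∈ , ∈-++⁺ʳ (leaves β) y∈βs , ∈-++⁺ʳ (leaves β) z∈βs ,
       headLeaf-apart u x∈ y∈βs ,
       ∉⇒apart u (there (here refl)) y∈ (λ z∈γ → precedes-irrefl u′ (precedes-++ z∈γ z∈γs)) ,
       headLeaf-apart u x∈ z∈βs

  -- Three leaves from three children, two colours: the lower bound of three children takes effect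
  -- here. It serves to refute a division of the leaves of a Q-node into two blocks.
  Q-pigeonhole : ∀ {βs} {ℓ} {L R : Pred A ℓ} →
    WellFormed (node Q βs) → Unique (forestLeaves βs) →
    (∀ {x} → x ∈ˡ forestLeaves βs → L x ⊎ R x) →
    ∃₂ λ x y → x ∈ˡ forestLeaves βs × y ∈ˡ forestLeaves βs × Apart βs x y ×
               (L x × L y ⊎ R x × R y)
  Q-pigeonhole {βs} {L = L} {R} w u f =
    let x , y , z , x∈ , y∈ , z∈ , xy , yz , xz = threeApart w u
    in pick x∈ y∈ z∈ xy yz xz (f x∈) (f y∈) (f z∈)
    where
    pick : ∀ {x y z} → x ∈ˡ forestLeaves βs → y ∈ˡ forestLeaves βs → z ∈ˡ forestLeaves βs →
           Apart βs x y → Apart βs y z → Apart βs x z → L x ⊎ R x → L y ⊎ R y → L z ⊎ R z →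
           ∃₂ λ x y → x ∈ˡ forestLeaves βs × y ∈ˡ forestLeaves βs × Apart βs x y ×
                      (L x × L y ⊎ R x × R y)
    pick x∈ y∈ z∈ xy yz xz (inj₁ a) (inj₁ b) _        = _ , _ , x∈ , y∈ , xy , inj₁ (a , b)
    pick x∈ y∈ z∈ xy yz xz (inj₁ a) (inj₂ b) (inj₁ c) = _ , _ , x∈ , z∈ , xz , inj₁ (a , c)
    pick x∈ y∈ z∈ xy yz xz (inj₁ a) (inj₂ b) (inj₂ c) = _ , _ , y∈ , z∈ , yz , inj₂ (b , c)
    pick x∈ y∈ z∈ xy yz xz (inj₂ a) (inj₁ b) (inj₁ c) = _ , _ , y∈ , z∈ , yz , inj₁ (b , c)
    pick x∈ y∈ z∈ xy yz xz (inj₂ a) (inj₁ b) (inj₂ c) = _ , _ , x∈ , z∈ , xz , inj₂ (a , c)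
    pick x∈ y∈ z∈ xy yz xz (inj₂ a) (inj₂ b) _        = _ , _ , x∈ , y∈ , xy , inj₂ (a , b)

  -- Parents.

  -- Both paths down from the root lead to `x`, so they agree as long as both continue. If one stops
  -- first, its child `β` contains the other node, whose witness `y` or `y′` outside `β` is then a
  -- contradiction.
  parent-unique : ∀ {T : PQTree A} {k k′ βs βs′ β x y y′} → Unique (leaves T) →
    x ∈ˡ leaves β →
    node k βs ⊑ T → β ∈ˡ βs → y ∈ˡ forestLeaves βs → y ∉ˡ leaves β →
    node k′ βs′ ⊑ T → β ∈ˡ βs′ → y′ ∈ˡ forestLeaves βs′ → y′ ∉ˡ leaves β →
    node k βs ≡ node k′ βs′
  parent-unique u x∈ here β∈ y∈ y∉ here β∈′ y∈′ y∉′ = refl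
  parent-unique u x∈ here β∈ y∈ y∉ (below γ∈ q) β∈′ y∈′ y∉′
    with children-disjoint u β∈ γ∈ x∈ (⊑-leaves q (child-leaf β∈′ x∈))
  ... | refl = contradiction (⊑-leaves q y∈′) y∉′
  parent-unique u x∈ (below γ∈ p) β∈ y∈ y∉ here β∈′ y∈′ y∉′
    with children-disjoint u β∈′ γ∈ x∈ (⊑-leaves p (child-leaf β∈ x∈))
  ... | refl = contradiction (⊑-leaves p y∈) y∉
  parent-unique u x∈ (below γ∈ p) β∈ y∈ y∉ (below γ∈′ q) β∈′ y∈′ y∉′
    with children-disjoint u γ∈ γ∈′ (⊑-leaves p (child-leaf β∈ x∈))
                                    (⊑-leaves q (child-leaf β∈′ x∈))
  -- The kind does not affect the leaves and cannot be inferred; `P` is an arbitrary choice.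
  ... | refl = parent-unique (⊑-unique (below {k = P} γ∈ here) u)
                 x∈ p β∈ y∈ y∉ q β∈′ y∈′ y∉′

  parent-below : ∀ {k βs β} {α : PQTree A} → β ∈ˡ βs → α ⊑ β →
                 ∃₂ λ k′ βs′ → node k′ βs′ ⊑ node k βs × α ∈ˡ βs′
  parent-below β∈ here         = _ , _ , here , β∈
  parent-below β∈ (below γ∈ p) =
    let k′ , βs′ , q , α∈ = parent-below γ∈ p in k′ , βs′ , below β∈ q , α∈

  parent : ∀ {T α : PQTree A} {x} → α ⊑ T → x ∈ˡ leaves T → x ∉ˡ leaves α →
           ∃₂ λ k βs → node k βs ⊑ T × α ∈ˡ βs
  parent here         x∈ x∉ = contradiction x∈ x∉
  parent (below β∈ p) _  _  = parent-below β∈ p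

module _ {n : ℕ} where

  open DecMembership (_≟_ {n}) using () renaming (_∈?_ to _∈ˡ?_)

  sibling : ∀ {k βs} {β : PQTree (Fin n)} → WellFormed (node k βs) →
            Unique (forestLeaves βs) → β ∈ˡ βs →
            ∃[ y ] (y ∈ˡ forestLeaves βs × y ∉ˡ leaves β)
  sibling {βs = βs} {β} w u β∈ =
    let x , y , x∈ , y∈ , xy = twoApart w u in pick x∈ y∈ xy (x ∈ˡ? leaves β)
    where
    pick : ∀ {x y} → x ∈ˡ forestLeaves βs → y ∈ˡ forestLeaves βs → Apart βs x y →
           Dec (x ∈ˡ leaves β) → ∃[ y ] (y ∈ˡ forestLeaves βs × y ∉ˡ leaves β)
    pick x∈ y∈ xy (yes x∈β) = _ , y∈ , xy β∈ x∈β
    pick x∈ y∈ xy (no x∉β)  = _ , x∈ , x∉β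

  meet : ∀ {T : PQTree (Fin n)} {p x} → leaf p ⊑ T → x ∈ˡ leaves T → x ≢ p →
    ∃[ k ] ∃[ βs ] ∃[ β ] (node k βs ⊑ T × β ∈ˡ βs × p ∈ˡ leaves β ×
                           x ∈ˡ forestLeaves βs × x ∉ˡ leaves β)
  meet here (here refl) x≢p = contradiction refl x≢p
  meet {x = x} (below {β = β} β∈ q) x∈ x≢p with x ∈ˡ? leaves β
  ... | no x∉β  = _ , _ , β , here , β∈ , leaf⇒∈ q , x∈ , x∉β
  ... | yes x∈β =
    let k , βs , γ , r , rest = meet q x∈β x≢p
    in k , βs , γ , below β∈ r , rest

-- Mmodules and compatible orders of the given space.

module PQTreeOf {c ℓ₁ ℓ₂} {V : DecTotalOrder c ℓ₁ ℓ₂} {0# : DecTotalOrder.Carrier V} {n : ℕ}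
                (D : Dissimilarity V 0# n) (T : PQTree (Fin n)) (isPQTree : IsPQTree T)
                (represents : RepresentsCompatibleOrders D T) where

  open DecTotalOrder V using (Carrier; _≈_; _≤_; totalOrder; antisym; module Eq)
    renaming (_≟_ to _≈?_; reflexive to ≤-reflexive; trans to ≤-trans; refl to ≤-refl)
  open Max totalOrder using (x≤x⊔y; x≤y⊔x; ⊔-lub)
  open Dissimilarity D
  open IsPQTree isPQTree
  open DecMembership (_≟_ {n}) using () renaming (_∈?_ to _∈ˡ?_)

  -- Stated for predicates, so that hulls, unions, leaf lists and relative complements can be used
  -- directly as mmodules.
  Mmodule : Pred (Fin n) 0ℓ → Set ℓ₁
  Mmodule N = ∀ {z x y} → ¬ N z → N x → N y → d z x ≈ d z y

  d-swap≤ : ∀ {w x y z} → d w x ≤ d y z → d x w ≤ d z y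
  d-swap≤ {w} {x} {y} {z} p =
    ≤-trans (≤-reflexive (symmetric x w)) (≤-trans p (≤-reflexive (symmetric y z)))

  d-swap≈ : ∀ {w x y z} → d w x ≈ d y z → d x w ≈ d z y
  d-swap≈ {w} {x} {y} {z} p = Eq.trans (symmetric x w) (Eq.trans p (symmetric y z))

  diagonal≤ : ∀ x {y z} → d x x ≤ d y z
  diagonal≤ x = ≤-trans (≤-reflexive (diagonal x)) (nonneg _ _)

  compatible⁺ : ∀ {_<_ : Rel (Fin n) 0ℓ} →
    (∀ {x y z} → x < y → y < z → d x y ≤ d x z × d y z ≤ d x z) → Compatible D _<_
  compatible⁺ f p q = let a , b = f p q in ⊔-lub a b

  compatible⁻ : ∀ {_<_ : Rel (Fin n) 0ℓ} → Compatible D _<_ →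
    ∀ {x y z} → x < y → y < z → d x y ≤ d x z × d y z ≤ d x z
  compatible⁻ compatible p q =
    ≤-trans (x≤x⊔y _ _) (compatible p q) , ≤-trans (x≤y⊔x _ _) (compatible p q)

  -- Reversal of an interval that is an mmodule.

  module Reversal {_<_ : Rel (Fin n) 0ℓ} (isSTO : IsStrictTotalOrder _≡_ _<_)
                  (compatible : Compatible D _<_)
                  {I : Pred (Fin n) 0ℓ} (I? : Decidable I) (mm : Mmodule I)
                  (convex : ∀ {x y z} → I x → I z → x < y → y < z → I y) where

    open IsStrictTotalOrder isSTO using (compare)
      renaming (trans to <-trans; irrefl to <-irrefl)

    infix 4 _<ᴿ_

    data _<ᴿ_ (x y : Fin n) : Set where
      within : I x → I y → y < x → x <ᴿ y
      across : ¬ (I x × I y) → x < y → x <ᴿ y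

    -- In the mixed cases convexity keeps the outside point from lying between the two inside
    -- points, so it stays on the same side of both.
    <ᴿ-trans : ∀ {x y z} → x <ᴿ y → y <ᴿ z → x <ᴿ z
    <ᴿ-trans (within x∈ _ y<x) (within _ z∈ z<y) = within x∈ z∈ (<-trans z<y y<x)
    <ᴿ-trans {x} {y} {z} (within x∈ y∈ y<x) (across ¬yz y<z) with compare x z
    ... | tri< x<z _ _  = across (λ (_ , z∈) → ¬yz (y∈ , z∈)) x<z
    ... | tri≈ _ refl _ = contradiction (y∈ , x∈) ¬yz
    ... | tri> _ _ z<x  = contradiction (y∈ , convex y∈ x∈ y<z z<x) ¬yz
    <ᴿ-trans {x} {y} {z} (across ¬xy x<y) (within y∈ z∈ z<y) with compare x z
    ... | tri< x<z _ _  = across (λ (x∈ , _) → ¬xy (x∈ , y∈)) x<z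
    ... | tri≈ _ refl _ = contradiction (z∈ , y∈) ¬xy
    ... | tri> _ _ z<x  = contradiction (convex z∈ y∈ z<x x<y , y∈) ¬xy
    <ᴿ-trans (across ¬xy x<y) (across _ y<z) =
      across (λ (x∈ , z∈) → ¬xy (x∈ , convex x∈ z∈ x<y y<z)) (<-trans x<y y<z)

    <ᴿ-irrefl : ∀ {x} → ¬ x <ᴿ x
    <ᴿ-irrefl (within _ _ x<x) = <-irrefl refl x<x
    <ᴿ-irrefl (across _ x<x)   = <-irrefl refl x<x

    <ᴿ-compare : Trichotomous _≡_ _<ᴿ_
    <ᴿ-compare x y with compare x y | I? x ×-dec I? y
    ... | tri≈ _ refl _ | _             = tri≈ <ᴿ-irrefl refl <ᴿ-irrefl
    ... | tri< x<y x≢y _ | yes (x∈ , y∈) = let y<ᴿx = within y∈ x∈ x<y in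
      tri> (λ x<ᴿy → <ᴿ-irrefl (<ᴿ-trans x<ᴿy y<ᴿx)) x≢y y<ᴿx
    ... | tri< x<y x≢y _ | no ¬xy        = let x<ᴿy = across ¬xy x<y in
      tri< x<ᴿy x≢y (λ y<ᴿx → <ᴿ-irrefl (<ᴿ-trans x<ᴿy y<ᴿx))
    ... | tri> _ x≢y y<x | yes (x∈ , y∈) = let x<ᴿy = within x∈ y∈ y<x in
      tri< x<ᴿy x≢y (λ y<ᴿx → <ᴿ-irrefl (<ᴿ-trans x<ᴿy y<ᴿx))
    ... | tri> _ x≢y y<x | no ¬xy        = let y<ᴿx = across (λ (y∈ , x∈) → ¬xy (x∈ , y∈)) y<x in
      tri> (λ x<ᴿy → <ᴿ-irrefl (<ᴿ-trans x<ᴿy y<ᴿx)) x≢y y<ᴿx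

    <ᴿ-isStrictTotalOrder : IsStrictTotalOrder _≡_ _<ᴿ_
    <ᴿ-isStrictTotalOrder = record
      { isStrictPartialOrder = record
        { isEquivalence = isEquivalence
        ; irrefl        = λ { refl → <ᴿ-irrefl }
        ; trans         = <ᴿ-trans
        ; <-resp-≈      = resp₂ _<ᴿ_
        }
      ; compare = <ᴿ-compare
      }

    -- In a triple with one reversed pair, the third point is outside `I` and sees that pair at one
    -- distance. This equality gives one inequality, and the original order gives the other.
    <ᴿ-compatible : Compatible D _<ᴿ_
    <ᴿ-compatible = compatible⁺ go
      where
      <-max = compatible⁻ compatible
      go : ∀ {x y z} → x <ᴿ y → y <ᴿ z → d x y ≤ d x z × d y z ≤ d x z
      go (within x∈ y∈ y<x) (within _ z∈ z<y) =
        let a , b = <-max z<y y<x in d-swap≤ b , d-swap≤ a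
      go p@(within x∈ y∈ y<x) q@(across ¬yz y<z) with <ᴿ-trans p q
      ... | within _ z∈ _ = contradiction (y∈ , z∈) ¬yz
      ... | across _ x<z  =
        let a , b = <-max y<x x<z
            eq    = d-swap≈ (mm (λ z∈ → ¬yz (y∈ , z∈)) y∈ x∈)
        in ≤-trans (d-swap≤ a) (≤-reflexive (Eq.trans (symmetric _ _) eq)) , ≤-reflexive eq
      go p@(across ¬xy x<y) q@(within y∈ z∈ z<y) with <ᴿ-trans p q
      ... | within x∈ _ _ = contradiction (x∈ , y∈) ¬xy
      ... | across _ x<z  =
        let a , b = <-max x<z z<y
            eq    = mm (λ x∈ → ¬xy (x∈ , y∈)) y∈ z∈
        in ≤-reflexive eq , ≤-trans (d-swap≤ b) (≤-reflexive (Eq.trans (symmetric _ _) eq))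
      go (across _ x<y) (across _ y<z) = <-max x<y y<z

  -- Leaf orders of equivalent trees.

  leaves-unique : ∀ {T′} → T ~ T′ → Unique (leaves T′)
  leaves-unique r = unique-resp-↭ (↭-trans (↭-sym leaves↭X) (leaves-~ r)) (allFin⁺ n)

  leaves-full : ∀ {T′} → T ~ T′ → ∀ x → x ∈ˡ leaves T′
  leaves-full r x = ∈-resp-↭ (↭-trans (↭-sym leaves↭X) (leaves-~ r)) (∈-allFin x)

  leafOrder-isStrictTotalOrder : ∀ {T′} → T ~ T′ →
    IsStrictTotalOrder _≡_ (Precedes (leaves T′))
  leafOrder-isStrictTotalOrder {T′} r = record
    { isStrictPartialOrder = record
      { isEquivalence = isEquivalence
      ; irrefl        = λ { refl → precedes-irrefl u }
      ; trans         = precedes-trans u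
      ; <-resp-≈      = resp₂ _
      }
    ; compare = compare
    }
    where
    u = leaves-unique r
    compare : Trichotomous _≡_ (Precedes (leaves T′))
    compare x y with x ≟ y
    ... | yes refl = tri≈ (precedes-irrefl u) refl (precedes-irrefl u)
    ... | no x≢y with precedes-total (leaves-full r x) (leaves-full r y) x≢y
    ...   | inj₁ p = tri< p x≢y (precedes-asym u p)
    ...   | inj₂ p = tri> (precedes-asym u p) x≢y p

  leafOrder-compatible : ∀ {T′} → T ~ T′ → Compatible D (Precedes (leaves T′))
  leafOrder-compatible {T′} r = Equivalence.from
    (represents _ (leafOrder-isStrictTotalOrder r)) (T′ , r , λ _ _ → mk⇔ id id)

  leafOrder-max : ∀ {T′ L} → T ~ T′ → leaves T′ ≡ L → ∀ {x y z} →
    Precedes L x y → Precedes L y z → d x y ≤ d x z × d y z ≤ d x z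
  leafOrder-max r refl = compatible⁻ (leafOrder-compatible r)

  -- The new tree is known only through how it orders pairs. That is enough to contradict
  -- `node-convex` or `neverBetween`.
  reverse-interval : ∀ {T′} → T ~ T′ → {I : Pred (Fin n) 0ℓ} → Decidable I → Mmodule I →
    (∀ {x y z} → I x → I z → Precedes (leaves T′) x y → Precedes (leaves T′) y z → I y) →
    ∃[ T″ ] (T ~ T″ ×
      (∀ {x y} → I x → I y → Precedes (leaves T′) x y → Precedes (leaves T″) y x) ×
      (∀ {x y} → ¬ (I x × I y) → Precedes (leaves T′) x y → Precedes (leaves T″) x y))
  reverse-interval r I? mm convex =
    let T″ , r′ , same = Equivalence.to (represents _<ᴿ_ <ᴿ-isStrictTotalOrder) <ᴿ-compatible
    in T″ , r′ ,
       (λ x∈ y∈ p → Equivalence.to (same _ _) (within y∈ x∈ p)) ,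
       (λ ¬xy p → Equivalence.to (same _ _) (across ¬xy p))
    where
    open Reversal (leafOrder-isStrictTotalOrder r) (leafOrder-compatible r) I? mm convex

  infix 4 _≺_ _≼_

  _≺_ _≼_ : Rel (Fin n) 0ℓ
  x ≺ y = Precedes (leaves T) x y
  x ≼ y = x ≡ y ⊎ x ≺ y

  open IsStrictTotalOrder (leafOrder-isStrictTotalOrder ε)
    using (compare) renaming (_<?_ to _≺?_; trans to ≺-trans; asym to ≺-asym)

  ≺-max : ∀ {x y z} → x ≺ y → y ≺ z → d x y ≤ d x z × d y z ≤ d x z
  ≺-max = leafOrder-max ε refl

  -- Nodes as mmodules and as intervals.

  node-unique : ∀ {α} → α ⊑ T → Unique (leaves α)
  node-unique p = ⊑-unique p (leaves-unique ε)

  -- Reversing the subtree α in place reverses only the order of the leaves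
  -- of α, so a point z outside cannot tell which of two leaves is the nearer.
  node-mmodule : ∀ {α} → α ⊑ T → Mmodule (_∈ˡ leaves α)
  node-mmodule {α} p {z} {x} {y} z∉ x∈ y∈ with x ≟ y
  ... | yes refl = Eq.refl
  ... | no x≢y   = [ go , Eq.sym ∘ go ]′ (precedes-total x∈ y∈ x≢y)
    where
    go : ∀ {x y} → Precedes (leaves α) x y → d z x ≈ d z y
    go {x} {y} x<y with replace p | mirror α
    ... | us , ws , f | α′ , s , eq with f ε | f s
    ... | T₁ , r₁ , eq₁ | T₂ , r₂ , eq₂
      with ∈-++⁻ us (subst (z ∈ˡ_) eq₁ (leaves-full r₁ z))
    ... | inj₁ z∈us = antisym
      (proj₁ (leafOrder-max r₁ eq₁ (precedes-++ z∈us (∈-++⁺ˡ (precedes-∈ˡ x<y)))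
                                   (⊆-++⁺ˡ us (⊆-++⁺ʳ ws x<y))))
      (proj₁ (leafOrder-max r₂ eq₂ (precedes-++ z∈us (∈-++⁺ˡ (precedes-∈ˡ y<x)))
                                   (⊆-++⁺ˡ us (⊆-++⁺ʳ ws y<x))))
      where y<x = subst (λ l → Precedes l y x) (sym eq) (⊆-reverse⁺ x<y)
    ... | inj₂ z∈ with ∈-++⁻ (leaves α) z∈
    ...   | inj₁ z∈α  = contradiction z∈α z∉
    ...   | inj₂ z∈ws = d-swap≈ (antisym
      (proj₂ (leafOrder-max r₂ eq₂ (⊆-++⁺ˡ us (⊆-++⁺ʳ ws y<x))
                                   (⊆-++⁺ˡ us (precedes-++ (precedes-∈ʳ y<x) z∈ws))))
      (proj₂ (leafOrder-max r₁ eq₁ (⊆-++⁺ˡ us (⊆-++⁺ʳ ws x<y))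
                                   (⊆-++⁺ˡ us (precedes-++ (precedes-∈ʳ x<y) z∈ws)))))
      where y<x = subst (λ l → Precedes l y x) (sym eq) (⊆-reverse⁺ x<y)

  -- The children of a P-node can be ordered with β first or β last, the
  -- other leaves keeping their order.
  P-complement : ∀ {βs β z x y} → node P βs ⊑ T → β ∈ˡ βs → z ∈ˡ leaves β →
    x ∈ˡ forestLeaves βs → x ∉ˡ leaves β → y ∈ˡ forestLeaves βs → y ∉ˡ leaves β →
    d z x ≈ d z y
  P-complement {β = β} {z} {x} {y} p β∈ z∈ x∈ x∉ y∈ y∉ with x ≟ y
  ... | yes refl = Eq.refl
  ... | no x≢y with ∈-∃++ β∈
  ...   | γs , δs , refl =
    [ go , Eq.sym ∘ go ]′ (precedes-total (rest x∈ x∉) (rest y∈ y∉) x≢y)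
    where
    βfirst : γs ++ β ∷ δs ↭ β ∷ γs ++ δs
    βfirst = shift β γs δs

    βlast : γs ++ β ∷ δs ↭ (γs ++ δs) ++ [ β ]
    βlast = ↭-trans βfirst (↭-++-comm [ β ] (γs ++ δs))

    rest : ∀ {x} → x ∈ˡ forestLeaves (γs ++ β ∷ δs) → x ∉ˡ leaves β →
           x ∈ˡ forestLeaves (γs ++ δs)
    rest x∈ x∉ = [ (λ x∈β → contradiction x∈β x∉) , id ]′
      (∈-++⁻ (leaves β) (∈-resp-↭ (forestLeaves-↭ βfirst) x∈))

    go : ∀ {x y} → Precedes (forestLeaves (γs ++ δs)) x y → d z x ≈ d z y
    go {x} {y} x<y with replace p
    ... | us , ws , f with f (permute βfirst ◅ ε) | f (permute βlast ◅ ε)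
    ... | T₁ , r₁ , eq₁ | T₂ , r₂ , eq₂ = antisym
      (proj₁ (leafOrder-max r₁ eq₁
        (⊆-++⁺ˡ us (⊆-++⁺ʳ ws (precedes-++ z∈ (precedes-∈ˡ x<y))))
        (⊆-++⁺ˡ us (⊆-++⁺ʳ ws (⊆-++⁺ˡ (leaves β) x<y)))))
      (d-swap≤ (proj₂ (leafOrder-max r₂ eq₂
        (⊆-++⁺ˡ us (⊆-++⁺ʳ ws (subst (λ l → Precedes l x y) last (⊆-++⁺ʳ _ x<y))))
        (⊆-++⁺ˡ us (⊆-++⁺ʳ ws (subst (λ l → Precedes l y z) last
                                 (precedes-++ (precedes-∈ʳ x<y) (∈-++⁺ˡ z∈))))))))
      where last = sym (forestLeaves-++ (γs ++ δs) [ β ])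

  node-aside : ∀ {α x y z} {S : PQTree (Fin n)} → α ⊑ S → x ∈ˡ leaves α → z ∈ˡ leaves α →
               y ∉ˡ leaves α → y ∈ˡ leaves S → NeverBetween y x z S
  node-aside here x∈ z∈ y∉ y∈ = contradiction y∈ y∉
  node-aside {y = y} (below {β = β} β∈ p) x∈ z∈ y∉ y∈ with y ∈ˡ? leaves β
  ... | yes y∈β = descend β∈ (node-aside p x∈ z∈ y∉ y∈β)
  ... | no y∉β  = aside β∈ (⊑-leaves p x∈) (⊑-leaves p z∈) y∉β y∈

  neverBetween : ∀ {T′ x y z} → T ~ T′ → NeverBetween y x z T →
    Precedes (leaves T′) x y → ¬ Precedes (leaves T′) y z
  neverBetween r s = neverBetween-sound (leaves-unique r) (neverBetween-~ r s)

  node-convex : ∀ {α T′ x y z} → α ⊑ T → T ~ T′ → x ∈ˡ leaves α → z ∈ˡ leaves α →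
    Precedes (leaves T′) x y → Precedes (leaves T′) y z → y ∈ˡ leaves α
  node-convex {α} {y = y} p r x∈ z∈ x<y y<z with y ∈ˡ? leaves α
  ... | yes y∈ = y∈
  ... | no y∉  = contradiction y<z
    (neverBetween r (node-aside p x∈ z∈ y∉ (leaves-full ε y)) x<y)

  -- The point `z` lies to one side of the interval `α`. Compatibility bounds `d x y` by the
  -- distance from `z` to the farther of `x` and `y`, and `z` sees both at the same distance.
  node-diameter : ∀ {α x y z} → α ⊑ T → x ∈ˡ leaves α → y ∈ˡ leaves α → z ∉ˡ leaves α →
                  d x y ≤ d x z
  node-diameter {α} {x} {y} {z} p x∈ y∈ z∉ =
    case compare x y of λ where
      (tri≈ _ refl _) → diagonal≤ x
      (tri< x≺y _ _)  → go x∈ y∈ x≺y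
      (tri> _ _ y≺x)  → ≤-trans (≤-reflexive (symmetric x y)) (≤-trans (go y∈ x∈ y≺x)
                          (≤-reflexive (d-swap≈ (node-mmodule p z∉ y∈ x∈))))
    where
    go : ∀ {x y} → x ∈ˡ leaves α → y ∈ˡ leaves α → x ≺ y → d x y ≤ d x z
    go {x} {y} x∈ y∈ x≺y with compare x z | compare y z
    ... | tri≈ _ refl _ | _             = contradiction x∈ z∉
    ... | _             | tri≈ _ refl _ = contradiction y∈ z∉
    ... | tri< x≺z _ _  | tri> _ _ z≺y  = contradiction (node-convex p ε x∈ y∈ x≺z z≺y) z∉
    ... | tri< _ _ _    | tri< y≺z _ _  = proj₁ (≺-max x≺y y≺z)
    ... | tri> _ _ z≺x  | _             = ≤-trans (proj₂ (≺-max z≺x x≺y))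
      (≤-reflexive (Eq.trans (node-mmodule p z∉ y∈ x∈) (symmetric z x)))

  before : ∀ {k βs x y} → node k βs ⊑ T → Apart βs x y → x ∈ˡ forestLeaves βs →
           y ∈ˡ forestLeaves βs → x ≺ y → Before x y βs
  before p a x∈ y∈ x≺y with ⊑-infix p
  ... | us , ws , eq = apart⇒before (node-unique p) a
    (precedes-infix us _ ws (subst Unique eq (leaves-unique ε)) x∈ y∈
                    (subst (λ l → Precedes l _ _) eq x≺y))

  -- Interval hulls of mmodules.

  _≼?_ : ∀ x y → Dec (x ≼ y)
  x ≼? y = x ≟ y ⊎-dec x ≺? y

  ≼-≺-trans : ∀ {x y z} → x ≼ y → y ≺ z → x ≺ z
  ≼-≺-trans (inj₁ refl) q = q
  ≼-≺-trans (inj₂ p)    q = ≺-trans p q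

  ≺-≼-trans : ∀ {x y z} → x ≺ y → y ≼ z → x ≺ z
  ≺-≼-trans p (inj₁ refl) = p
  ≺-≼-trans p (inj₂ q)    = ≺-trans p q

  mono-above : ∀ {x y z} → z ≺ x → x ≼ y → d z x ≤ d z y
  mono-above z≺x (inj₁ refl) = ≤-refl
  mono-above z≺x (inj₂ x≺y)  = proj₁ (≺-max z≺x x≺y)

  mono-below : ∀ {x y z} → x ≼ y → y ≺ z → d z y ≤ d z x
  mono-below (inj₁ refl) y≺z = ≤-refl
  mono-below (inj₂ x≺y)  y≺z = d-swap≤ (proj₂ (≺-max x≺y y≺z))

  module Hull {N : Pred (Fin n) 0ℓ} (N? : Decidable N) (mm : Mmodule N) where

    H : Pred (Fin n) 0ℓ
    H x = (∃[ u ] (N u × u ≼ x)) × (∃[ v ] (N v × x ≼ v))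

    H? : Decidable H
    H? x = any? (λ u → N? u ×-dec (u ≼? x)) ×-dec any? (λ v → N? v ×-dec (x ≼? v))

    N⊆H : ∀ {x} → N x → H x
    N⊆H Nx = (_ , Nx , inj₁ refl) , (_ , Nx , inj₁ refl)

    H-convex : ∀ {x y z} → H x → H z → x ≺ y → y ≺ z → H y
    H-convex ((u , Nu , u≼x) , _) (_ , (v , Nv , z≼v)) x≺y y≺z =
      (u , Nu , inj₂ (≼-≺-trans u≼x x≺y)) , (v , Nv , inj₂ (≺-≼-trans y≺z z≼v))

    -- A point outside the hull has all of `N` on one side. Its distance to a point of the hull is
    -- squeezed between its distances to two points of `N`, which are equal.
    H-mmodule : Mmodule H
    H-mmodule {z} z∉ ((u , Nu , u≼x) , (v , Nv , x≼v)) ((u′ , Nu′ , u′≼y) , (v′ , Nv′ , y≼v′)) =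
      Eq.trans (squeeze Nu u≼x Nv x≼v)
        (Eq.trans (mm (z∉ ∘ N⊆H) Nu Nu′) (Eq.sym (squeeze Nu′ u′≼y Nv′ y≼v′)))
      where
      squeeze : ∀ {u v x} → N u → u ≼ x → N v → x ≼ v → d z x ≈ d z u
      squeeze {u} {v} Nu u≼x Nv x≼v with compare z u | compare v z
      ... | tri< z≺u _ _ | _ = antisym
        (≤-trans (mono-above (≺-≼-trans z≺u u≼x) x≼v) (≤-reflexive (mm (z∉ ∘ N⊆H) Nv Nu)))
        (mono-above z≺u u≼x)
      ... | _ | tri< v≺z _ _ = antisym
        (mono-below u≼x (≼-≺-trans x≼v v≺z))
        (≤-trans (≤-reflexive (mm (z∉ ∘ N⊆H) Nu Nv)) (mono-below x≼v v≺z))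
      ... | tri≈ _ refl _ | _ = contradiction (N⊆H Nu) z∉
      ... | _ | tri≈ _ refl _ = contradiction (N⊆H Nv) z∉
      ... | tri> _ _ u≺z | tri> _ _ z≺v =
        contradiction ((u , Nu , inj₂ u≺z) , (v , Nv , inj₂ z≺v)) z∉

    -- Otherwise reversing the hull would change the order of the children of
    -- the Q-node to one that is neither the original nor its reverse.
    Q-spanned : ∀ {βs x y s} → node Q βs ⊑ T → N x → N y → x ∈ˡ forestLeaves βs →
      y ∈ˡ forestLeaves βs → Apart βs x y → x ≺ y → s ∈ˡ forestLeaves βs → H s
    Q-spanned {βs} {x} {y} {s} p Nx Ny x∈ y∈ xy x≺y s∈ with H? s
    ... | yes Hs = Hs
    ... | no ¬Hs with reverse-interval ε H? H-mmodule H-convex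
                    | childOf βs x∈ | childOf βs y∈
    ...   | T″ , r , inner , outer | β , β∈ , x∈β | γ , γ∈ , y∈γ
      with compare s x | compare s y
    ... | tri≈ _ refl _ | _             = N⊆H Nx
    ... | _             | tri≈ _ refl _ = N⊆H Ny
    ... | tri> _ _ x≺s  | tri< s≺y _ _  = (x , Nx , inj₂ x≺s) , (y , Ny , inj₂ s≺y)
    ... | tri< s≺x _ _  | tri> _ _ y≺s  = contradiction (≺-trans s≺x x≺y) (≺-asym y≺s)
    ... | tri< s≺x _ _  | tri< s≺y _ _  with s ∈ˡ? leaves β | s ∈ˡ? leaves γ
    ...   | yes s∈β | _ = contradiction
      (node-convex (child-⊑ p β∈) r s∈β x∈β (outer (¬Hs ∘ proj₁) s≺y)
                   (inner (N⊆H Nx) (N⊆H Ny) x≺y))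
      (xy β∈ x∈β)
    ...   | _ | yes s∈γ = contradiction y∈γ
      (xy γ∈ (node-convex (child-⊑ p γ∈) ε s∈γ y∈γ s≺x x≺y))
    ...   | no s∉β | no s∉γ = contradiction (inner (N⊆H Nx) (N⊆H Ny) x≺y)
      (neverBetween r (neverBetween-⊑ p (right (before p sy s∈ y∈ s≺y) (before p xy x∈ y∈ x≺y)))
                    (outer (¬Hs ∘ proj₁) s≺y))
      where sy = apart-sym (∉⇒apart (node-unique p) γ∈ y∈γ s∉γ)
    Q-spanned {βs} {x} {y} {s} p Nx Ny x∈ y∈ xy x≺y s∈ | no ¬Hs
      | T″ , r , inner , outer | β , β∈ , x∈β | γ , γ∈ , y∈γ
      | tri> _ _ x≺s  | tri> _ _ y≺s  with s ∈ˡ? leaves β | s ∈ˡ? leaves γ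
    ...   | yes s∈β | _ = contradiction
      (node-convex (child-⊑ p β∈) ε x∈β s∈β x≺y y≺s) (xy β∈ x∈β)
    ...   | _ | yes s∈γ = contradiction y∈γ
      (xy γ∈ (node-convex (child-⊑ p γ∈) r y∈γ s∈γ (inner (N⊆H Nx) (N⊆H Ny) x≺y)
                          (outer (¬Hs ∘ proj₂) x≺s)))
    ...   | no s∉β | no s∉γ = contradiction (outer (¬Hs ∘ proj₂) x≺s)
      (neverBetween r (neverBetween-⊑ p (left (before p xy x∈ y∈ x≺y) (before p xs x∈ s∈ x≺s)))
                    (inner (N⊆H Nx) (N⊆H Ny) x≺y))
      where xs = ∉⇒apart (node-unique p) β∈ x∈β s∉β

    -- The strict form of hull membership: equality at an end puts `s` in `N`, and otherwise there
    -- are points of `N` strictly on both sides, to which compatibility applies.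
    Q-straddled : ∀ {βs x y s} → node Q βs ⊑ T → N x → N y → x ∈ˡ forestLeaves βs →
      y ∈ˡ forestLeaves βs → Apart βs x y → s ∈ˡ forestLeaves βs →
      N s ⊎ (∃[ u ] (N u × u ≺ s)) × (∃[ v ] (N v × s ≺ v))
    Q-straddled {βs} {x} {y} {s} p Nx Ny x∈ y∈ xy s∈ = strict spanned
      where
      spanned : H s
      spanned with compare x y
      ... | tri< x≺y _ _  = Q-spanned p Nx Ny x∈ y∈ xy x≺y s∈
      ... | tri> _ _ y≺x  = Q-spanned p Ny Nx y∈ x∈ (apart-sym {βs = βs} xy) y≺x s∈
      ... | tri≈ _ refl _ = let β , β∈ , x∈β = childOf βs x∈ in contradiction x∈β (xy β∈ x∈β)
      strict : H s → _
      strict ((u , Nu , inj₁ refl) , _)               = inj₁ Nu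
      strict (_ , (v , Nv , inj₁ refl))               = inj₁ Nv
      strict ((u , Nu , inj₂ u≺s) , (v , Nv , inj₂ s≺v)) = inj₂ ((u , Nu , u≺s) , (v , Nv , s≺v))

  mmodule-∪ : ∀ {M N : Pred (Fin n) 0ℓ} {w} → Mmodule M → Mmodule N → M w → N w →
              Mmodule (λ x → M x ⊎ N x)
  mmodule-∪ {M} {N} {w} mM mN Mw Nw z∉ x∈ y∈ = Eq.trans (to-w x∈) (Eq.sym (to-w y∈))
    where
    to-w : ∀ {x} → M x ⊎ N x → d _ x ≈ d _ w
    to-w (inj₁ Mx) = mM (z∉ ∘ inj₁) Mx Mw
    to-w (inj₂ Nx) = mN (z∉ ∘ inj₂) Nx Nw

  ∈X⁺ : ∀ {α : PQTree (Fin n)} {x} → x ∈ˡ leaves α → x ∈ X⟨ α ⟩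
  ∈X⁺ {α} = go (leaves α)
    where
    go : ∀ xs {x} → x ∈ˡ xs → x ∈ ⋃ (map ⁅_⁆ xs)
    go (y ∷ xs) (here refl) = x∈p∪q⁺ (inj₁ (x∈⁅x⁆ y))
    go (y ∷ xs) (there x∈)  = x∈p∪q⁺ (inj₂ (go xs x∈))

  ∈X⁻ : ∀ {α : PQTree (Fin n)} {x} → x ∈ X⟨ α ⟩ → x ∈ˡ leaves α
  ∈X⁻ {α} = go (leaves α)
    where
    go : ∀ xs {x} → x ∈ ⋃ (map ⁅_⁆ xs) → x ∈ˡ xs
    go []       x∈ = contradiction x∈ ∉⊥
    go (y ∷ xs) x∈ = [ here ∘ x∈⁅y⁆⇒x≡y y , there ∘ go xs ]′ (x∈p∪q⁻ ⁅ y ⁆ _ x∈)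

  -- Connectivity of the graph of distances other than δ.

  -- The blocks are consecutive in the list, not an arbitrary bipartition, because they are later
  -- used as pieces of intervals and compared with hulls.
  record Cut (δ : Carrier) (xs : List (Fin n)) : Set ℓ₁ where
    field
      {as bs} : List (Fin n)
      {a b}   : Fin n
      split   : xs ≡ as ++ bs
      a∈as    : a ∈ˡ as
      b∈bs    : b ∈ˡ bs
      cross   : ∀ {x y} → x ∈ˡ as → y ∈ˡ bs → d x y ≈ δ

  -- If no two consecutive points are at distance δ, they form a path;
  -- otherwise, δ being the diameter, the list can be cut between them.
  path-or-cut : ∀ δ {S} xs → (∀ {x} → x ∈ˡ xs → x ∈ S) → Unique xs →
    (∀ {x y z} → Precedes xs x y → Precedes xs y z → d x y ≤ d x z × d y z ≤ d x z) →
    (∀ {x y} → x ∈ˡ xs → y ∈ˡ xs → d x y ≤ δ) →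
    (∀ {x y} → x ∈ˡ xs → y ∈ˡ xs → Star (Edge D δ S) x y) ⊎ Cut δ xs
  path-or-cut δ []       xs⊆S u mx bound = inj₁ (λ ())
  path-or-cut δ (x ∷ []) xs⊆S u mx bound = inj₁ (λ { (here refl) (here refl) → ε })
  path-or-cut δ {S} (x ∷ y ∷ xs) xs⊆S u@(_ ∷ u′) mx bound with d x y ≈? δ
  ... | yes dxy≈δ = inj₂ record
    { as = [ x ] ; split = refl ; a∈as = here refl ; b∈bs = here refl
    ; cross = λ { (here refl) (here refl) → dxy≈δ
                ; (here refl) (there z∈)  → antisym (bound (here refl) (there (there z∈)))
                    (≤-trans (≤-reflexive (Eq.sym dxy≈δ))
                      (proj₁ (mx (refl ∷ from∈ (here refl)) (x ∷ʳ (refl ∷ from∈ z∈))))) }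
    }
  ... | no dxy≉δ with path-or-cut δ (y ∷ xs) (xs⊆S ∘ there) u′
                       (λ p q → mx (x ∷ʳ p) (x ∷ʳ q)) (λ p q → bound (there p) (there q))
  ...   | inj₁ paths = inj₁ extended
    where
    x≢y : x ≢ y
    x≢y refl = Unique[x∷xs]⇒x∉xs u (here refl)
    xy : Edge D δ S x y
    xy = xs⊆S (here refl) , xs⊆S (there (here refl)) , x≢y , dxy≉δ
    yx : Edge D δ S y x
    yx = xs⊆S (there (here refl)) , xs⊆S (here refl) , x≢y ∘ sym ,
         dxy≉δ ∘ Eq.trans (symmetric x y)
    extended : ∀ {v w} → v ∈ˡ x ∷ y ∷ xs → w ∈ˡ x ∷ y ∷ xs → Star (Edge D δ S) v w
    extended (here refl) (here refl) = ε
    extended (here refl) (there w∈)  = xy ◅ paths (here refl) w∈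
    extended (there v∈)  (here refl) = paths v∈ (here refl) ◅◅ yx ◅ ε
    extended (there v∈)  (there w∈)  = paths v∈ w∈
  -- The first block of the recursive cut begins with `y`. For `z` in the second block, `d x z` is
  -- at least `d y z`, which is `δ`, and at most the bound `δ`.
  ...   | inj₂ record { as = _ ∷ as ; bs = bs ; split = refl ; b∈bs = b∈ ; cross = cross } = inj₂ record
    { as = x ∷ y ∷ as ; bs = bs ; split = refl ; a∈as = here refl ; b∈bs = b∈
    ; cross = λ { (here refl) z∈ → antisym (bound (here refl) (there (there (∈-++⁺ʳ as z∈))))
                    (≤-trans (≤-reflexive (Eq.sym (cross (here refl) z∈)))
                      (proj₂ (mx (refl ∷ from∈ (here refl))
                                 (x ∷ʳ (refl ∷ from∈ (∈-++⁺ʳ as z∈))))))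
                ; (there w∈) z∈ → cross w∈ z∈ }
    }

  node-path-or-cut : ∀ δ {α} → α ⊑ T → (∀ {x y} → x ∈ˡ leaves α → y ∈ˡ leaves α → d x y ≤ δ) →
    Connected D δ X⟨ α ⟩ ⊎ Cut δ (leaves α)
  node-path-or-cut δ {α} p bound with ⊑-infix p
  ... | us , ws , eq = map₁ (λ paths x∈ y∈ → paths (∈X⁻ {α} x∈) (∈X⁻ {α} y∈))
    (path-or-cut δ (leaves α) (∈X⁺ {α}) (node-unique p)
      (λ x<y y<z → leafOrder-max ε eq (⊆-++⁺ˡ us (⊆-++⁺ʳ ws x<y)) (⊆-++⁺ˡ us (⊆-++⁺ʳ ws y<z)))
      bound)

  stays : ∀ {δ S} {A : Pred (Fin n) 0ℓ} → (∀ {x y} → Edge D δ S x y → A x → A y) →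
          ∀ {x y} → Star (Edge D δ S) x y → A x → A y
  stays step ε       Ax = Ax
  stays step (e ◅ r) Ax = stays step r (step e Ax)

  -- No edge leaves the first block, so a path from `a` to `b` would put `b` in both blocks.
  cut⇒disconnected : ∀ {δ α} → α ⊑ T → Cut δ (leaves α) → ¬ Connected D δ X⟨ α ⟩
  cut⇒disconnected {δ} {α} p
    record { as = as ; bs = bs ; split = eq ; a∈as = a∈ ; b∈bs = b∈ ; cross = cross } connected =
    precedes-irrefl u (precedes-++ b∈as b∈)
    where
    u : Unique (as ++ bs)
    u = subst Unique eq (node-unique p)
    in-α : ∀ {x} → x ∈ˡ as ++ bs → x ∈ X⟨ α ⟩
    in-α x∈ = ∈X⁺ {α} (subst (_ ∈ˡ_) (sym eq) x∈)
    step : ∀ {x y} → Edge D δ X⟨ α ⟩ x y → x ∈ˡ as → y ∈ˡ as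
    step (_ , y∈ , _ , ≉δ) x∈ = [ id , (λ y∈bs → contradiction (cross x∈ y∈bs) ≉δ) ]′
      (∈-++⁻ as (subst (_ ∈ˡ_) eq (∈X⁻ {α} y∈)))
    b∈as = stays step (connected (in-α (∈-++⁺ˡ a∈)) (in-α (∈-++⁺ʳ as b∈))) a∈

  -- If the node were cut, each block would be an mmodule: the other block is at distance `δ` from
  -- it, and points outside the node cannot tell its leaves apart. One block meets two children and
  -- so must straddle or contain every leaf of the node, yet the other block lies entirely on one
  -- side of it.
  Q-connected : ∀ {δ βs} → node Q βs ⊑ T →
    (∀ {x y} → x ∈ˡ forestLeaves βs → y ∈ˡ forestLeaves βs → d x y ≤ δ) →
    Connected D δ X⟨ node Q βs ⟩
  Q-connected {δ} {βs} p bound with node-path-or-cut δ p bound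
  ... | inj₁ connected = connected
  ... | inj₂ record { as = as ; bs = bs ; split = eq ; a∈as = a∈ ; b∈bs = b∈ ; cross = cross } = case
    Q-pigeonhole {L = _∈ˡ as} {R = _∈ˡ bs} (wellFormed-⊑ p wellFormed) (node-unique p)
                 (∈-++⁻ as ∘ subst (_ ∈ˡ_) eq) of λ where
      (x , y , x∈ , y∈ , xy , inj₁ (x∈as , y∈as)) → contradiction
        (Hull.Q-straddled (_∈ˡ? as) as-mmodule p x∈as y∈as x∈ y∈ xy (whole (∈-++⁺ʳ as b∈)))
        [ (λ b∈as → precedes-irrefl u (precedes-++ b∈as b∈)) ,
          (λ (_ , v , v∈as , b≺v) → ≺-asym b≺v (a≺b v∈as b∈)) ]′
      (x , y , x∈ , y∈ , xy , inj₂ (x∈bs , y∈bs)) → contradiction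
        (Hull.Q-straddled (_∈ˡ? bs) bs-mmodule p x∈bs y∈bs x∈ y∈ xy (whole (∈-++⁺ˡ a∈)))
        [ (λ a∈bs → precedes-irrefl u (precedes-++ a∈ a∈bs)) ,
          (λ ((v , v∈bs , v≺a) , _) → ≺-asym v≺a (a≺b a∈ v∈bs)) ]′
    where
    u : Unique (as ++ bs)
    u = subst Unique eq (node-unique p)
    whole : ∀ {x} → x ∈ˡ as ++ bs → x ∈ˡ forestLeaves βs
    whole = subst (_ ∈ˡ_) (sym eq)
    a≺b : ∀ {x y} → x ∈ˡ as → y ∈ˡ bs → x ≺ y
    a≺b x∈ y∈ = let us , ws , eq′ = ⊑-infix p in subst (λ l → Precedes l _ _) (sym eq′)
      (⊆-++⁺ˡ us (⊆-++⁺ʳ ws (subst (λ l → Precedes l _ _) (sym eq) (precedes-++ x∈ y∈))))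
    as-mmodule : Mmodule (_∈ˡ as)
    as-mmodule {z} z∉ x∈ y∈ with z ∈ˡ? bs
    ... | yes z∈bs = d-swap≈ (Eq.trans (cross x∈ z∈bs) (Eq.sym (cross y∈ z∈bs)))
    ... | no z∉bs  = node-mmodule p (λ z∈ → [ z∉ , z∉bs ]′ (∈-++⁻ as (subst (_ ∈ˡ_) eq z∈)))
                       (whole (∈-++⁺ˡ x∈)) (whole (∈-++⁺ˡ y∈))
    bs-mmodule : Mmodule (_∈ˡ bs)
    bs-mmodule {z} z∉ x∈ y∈ with z ∈ˡ? as
    ... | yes z∈as = Eq.trans (cross z∈as x∈) (Eq.sym (cross z∈as y∈))
    ... | no z∉as  = node-mmodule p (λ z∈ → [ z∉as , z∉ ]′ (∈-++⁻ as (subst (_ ∈ˡ_) eq z∈)))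
                       (whole (∈-++⁺ʳ as x∈)) (whole (∈-++⁺ʳ as y∈))

  -- With β = as ∪ bs placed first among its siblings, the interval formed by
  -- bs and the siblings is an mmodule, and reversing it disconnects β.
  P-uncut : ∀ {δ βs β} → node P βs ⊑ T → β ∈ˡ βs →
    (∀ {x t} → x ∈ˡ leaves β → t ∈ˡ forestLeaves βs → t ∉ˡ leaves β → d x t ≈ δ) →
    ¬ Cut δ (leaves β)
  P-uncut {δ} {β = β} p β∈ far
    record { as = as ; bs = bs ; split = eq ; a∈as = a∈ ; b∈bs = b∈ ; cross = cross }
    with ∈-∃++ β∈ | sibling (wellFormed-⊑ p wellFormed) (node-unique p) β∈ | replace p
  ... | γs , δs , refl | r , r∈ , r∉ | us , ws , f =
    let T₁ , r₁ , eq₁ = f (permute βfirst ◅ ε)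
        eq₂ = trans eq₁ regroup
        in-T₁ : ∀ {x y} → Precedes ((us ++ as) ++ (bs ++ rest) ++ ws) x y → Precedes (leaves T₁) x y
        in-T₁ = subst (λ l → Precedes l _ _) (sym eq₂)
        T₂ , r₂ , inner , outer = reverse-interval r₁ (_∈ˡ? (bs ++ rest)) mmodule
          (λ x∈ z∈ x<y y<z → infix-convex (us ++ as) (bs ++ rest) ws
            (subst Unique eq₂ (leaves-unique r₁)) x∈ z∈
            (subst (λ l → Precedes l _ _) eq₂ x<y) (subst (λ l → Precedes l _ _) eq₂ y<z))
        a<r = in-T₁ (precedes-++ (∈-++⁺ʳ us a∈) (∈-++⁺ˡ (∈-++⁺ʳ bs (in-rest r∈ r∉))))
        b<r = in-T₁ (⊆-++⁺ˡ (us ++ as) (⊆-++⁺ʳ ws (precedes-++ b∈ (in-rest r∈ r∉))))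
    -- In the new order the sibling leaf `r` lies between `a` and `b`: the pair `a`, `r` is kept and
    -- the pair `b`, `r` is reversed.
    in r∉ (node-convex (child-⊑ p β∈) r₂ (whole (∈-++⁺ˡ a∈)) (whole (∈-++⁺ʳ as b∈))
             (outer (as-outside a∈ ∘ proj₁) a<r)
             (inner (∈-++⁺ˡ b∈) (∈-++⁺ʳ bs (in-rest r∈ r∉)) b<r))
    where
    rest = forestLeaves (γs ++ δs)

    βfirst : γs ++ β ∷ δs ↭ β ∷ γs ++ δs
    βfirst = shift β γs δs

    u : Unique (leaves β ++ rest)
    u = unique-resp-↭ (forestLeaves-↭ βfirst) (node-unique p)

    whole : ∀ {x} → x ∈ˡ as ++ bs → x ∈ˡ leaves β
    whole = subst (_ ∈ˡ_) (sym eq)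

    in-rest : ∀ {x} → x ∈ˡ forestLeaves (γs ++ β ∷ δs) → x ∉ˡ leaves β → x ∈ˡ rest
    in-rest x∈ x∉ = [ (λ x∈β → contradiction x∈β x∉) , id ]′
      (∈-++⁻ (leaves β) (∈-resp-↭ (forestLeaves-↭ βfirst) x∈))

    in-α : ∀ {x} → x ∈ˡ leaves β ++ rest → x ∈ˡ forestLeaves (γs ++ β ∷ δs)
    in-α = ∈-resp-↭ (forestLeaves-↭ (↭-sym βfirst))

    in-α′ : ∀ {x} → x ∈ˡ bs ++ rest → x ∈ˡ forestLeaves (γs ++ β ∷ δs)
    in-α′ x∈ = in-α ([ ∈-++⁺ˡ ∘ whole ∘ ∈-++⁺ʳ as , ∈-++⁺ʳ (leaves β) ]′ (∈-++⁻ bs x∈))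

    regroup : us ++ (leaves β ++ rest) ++ ws ≡ (us ++ as) ++ (bs ++ rest) ++ ws
    regroup = begin
      us ++ (leaves β ++ rest) ++ ws    ≡⟨ cong (λ l → us ++ (l ++ rest) ++ ws) eq ⟩
      us ++ ((as ++ bs) ++ rest) ++ ws  ≡⟨ cong (λ l → us ++ l ++ ws) (++-assoc as bs rest) ⟩
      us ++ (as ++ bs ++ rest) ++ ws    ≡⟨ cong (us ++_) (++-assoc as (bs ++ rest) ws) ⟩
      us ++ as ++ (bs ++ rest) ++ ws    ≡⟨ sym (++-assoc us as _) ⟩
      (us ++ as) ++ (bs ++ rest) ++ ws  ∎
      where open ≡-Reasoning

    as-outside : ∀ {x} → x ∈ˡ as → x ∉ˡ bs ++ rest
    as-outside x∈ x∈V with ∈-++⁻ bs x∈V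
    ... | inj₁ x∈bs = precedes-irrefl (subst Unique eq (unique-++⁻ˡ (leaves β) u))
                                      (precedes-++ x∈ x∈bs)
    ... | inj₂ x∈rest = precedes-irrefl u (precedes-++ (whole (∈-++⁺ˡ x∈)) x∈rest)

    from-as : ∀ {z x} → z ∈ˡ as → x ∈ˡ bs ++ rest → d z x ≈ δ
    from-as z∈ x∈ with ∈-++⁻ bs x∈
    ... | inj₁ x∈bs   = cross z∈ x∈bs
    ... | inj₂ x∈rest = far (whole (∈-++⁺ˡ z∈)) (in-α (∈-++⁺ʳ (leaves β) x∈rest))
                            (λ x∈β → precedes-irrefl u (precedes-++ x∈β x∈rest))

    mmodule : Mmodule (_∈ˡ bs ++ rest)
    mmodule {z} z∉ x∈ y∈ with z ∈ˡ? as
    ... | yes z∈ = Eq.trans (from-as z∈ x∈) (Eq.sym (from-as z∈ y∈))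
    ... | no z∉as = node-mmodule p ∉α (in-α′ x∈) (in-α′ y∈)
      where
      ∉α : z ∉ˡ forestLeaves (γs ++ β ∷ δs)
      ∉α z∈ with z ∈ˡ? leaves β
      ... | yes z∈β = [ z∉as , z∉ ∘ ∈-++⁺ˡ ]′ (∈-++⁻ as (subst (_ ∈ˡ_) eq z∈β))
      ... | no z∉β  = z∉ (∈-++⁺ʳ bs (in-rest z∈ z∉β))

  -- Mmodules overlapping a node.

  -- The points `a`, `b`, `c` witness the three parts of the overlap: `β` outside `N`, the
  -- intersection, and `N` outside `β`. The aim is that `β` has constant distance `δ` to its
  -- siblings and is disconnected for this `δ`.
  module Overlap {k βs β} {N : Pred (Fin n) 0ℓ} {a b c : Fin n}
                 (p : node k βs ⊑ T) (β∈ : β ∈ˡ βs) (N? : Decidable N) (mm : Mmodule N)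
                 (a∈ : a ∈ˡ leaves β) (a∉N : ¬ N a) (b∈ : b ∈ˡ leaves β) (b∈N : N b)
                 (c∈N : N c) (c∉ : c ∉ˡ leaves β) where

    δ : Carrier
    δ = d a c

    β⊑ : β ⊑ T
    β⊑ = child-⊑ p β∈

    β-mm : Mmodule (_∈ˡ leaves β)
    β-mm = node-mmodule β⊑

    outside-inside : ∀ {x y} → x ∈ˡ leaves β → ¬ N x → N y → d x y ≈ δ
    outside-inside x∈ x∉N y∈N = Eq.trans (mm x∉N y∈N c∈N) (d-swap≈ (β-mm c∉ x∈ a∈))

    to-N : ∀ {x t} → x ∈ˡ leaves β → N t → t ∉ˡ leaves β → d x t ≈ δ
    to-N x∈ t∈N t∉ = Eq.trans (d-swap≈ (β-mm t∉ x∈ a∈)) (outside-inside a∈ a∉N t∈N)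

    -- The value `δ` is also attained inside `β`, as `d a b`, so it is at most the distance from `a`
    -- to any point outside.
    far≥δ : ∀ {t} → t ∉ˡ leaves β → δ ≤ d a t
    far≥δ t∉ = ≤-trans (≤-reflexive (Eq.sym (outside-inside a∈ a∉N b∈N)))
                       (node-diameter β⊑ a∈ b∈ t∉)

    diameter≤δ : ∀ {x y} → x ∈ˡ leaves β → y ∈ˡ leaves β → d x y ≤ δ
    diameter≤δ x∈ y∈ = ≤-trans (node-diameter β⊑ x∈ y∈ c∉) (≤-reflexive (to-N x∈ c∈N c∉))

    disconnected : ¬ Connected D δ X⟨ β ⟩
    disconnected connected = stays
      (λ (x∈ , _ , _ , ≉δ) x∉N y∈N → ≉δ (outside-inside (∈X⁻ {β} x∈) x∉N y∈N))
      (connected (∈X⁺ {β} a∈) (∈X⁺ {β} b∈)) a∉N b∈N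

    -- Let `t` be outside `N`. If `c` is outside the parent, the mmodules `β`, `N` and the parent
    -- link `d a t` to `d a c` in turn. If `c` is inside a P-node, `a` sees `t` and `c` alike. If it
    -- is inside a Q-node, the union of `β` and `N` is an mmodule straddling `t`; its point beyond
    -- `t`, as seen from `a`, is not in `β` by convexity, so it is in `N`, which gives the upper
    -- bound `δ`.
    equidistant-from-a : ∀ {t} → t ∈ˡ forestLeaves βs → t ∉ˡ leaves β → d a t ≈ δ
    equidistant-from-a {t} t∈ t∉ with N? t | c ∈ˡ? forestLeaves βs
    ... | yes t∈N | _ = to-N a∈ t∈N t∉
    ... | no t∉N | no c∉α = Eq.trans (symmetric a t) (Eq.trans (β-mm t∉ a∈ b∈)
      (Eq.trans (mm t∉N b∈N c∈N) (d-swap≈ (node-mmodule p c∉α t∈ (child-leaf β∈ a∈)))))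
    ... | no t∉N | yes c∈ = by-kind k p
      where
      by-kind : ∀ k → node k βs ⊑ T → d a t ≈ δ
      by-kind P p = P-complement p β∈ a∈ t∈ t∉ c∈ c∉
      by-kind Q p with Hull.Q-straddled (λ x → x ∈ˡ? leaves β ⊎-dec N? x)
        (mmodule-∪ β-mm mm b∈ b∈N) p (inj₁ a∈) (inj₂ c∈N) (child-leaf β∈ a∈) c∈
        (∉⇒apart (node-unique p) β∈ a∈ c∉) t∈
      ... | inj₁ (inj₁ t∈β) = contradiction t∈β t∉
      ... | inj₁ (inj₂ t∈N) = contradiction t∈N t∉N
      ... | inj₂ ((u , u∈ , u≺t) , (v , v∈ , t≺v)) with compare a t | u∈ | v∈
      ...   | tri≈ _ refl _ | _ | _ = contradiction a∈ t∉
      ...   | tri< a≺t _ _ | _ | inj₁ v∈β = contradiction (node-convex β⊑ ε a∈ v∈β a≺t t≺v) t∉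
      ...   | tri> _ _ t≺a | inj₁ u∈β | _ = contradiction (node-convex β⊑ ε u∈β a∈ u≺t t≺a) t∉
      ...   | tri< a≺t _ _ | _ | inj₂ v∈N = antisym
        (≤-trans (proj₁ (≺-max a≺t t≺v)) (≤-reflexive (to-N a∈ v∈N
          (λ v∈β → t∉ (node-convex β⊑ ε a∈ v∈β a≺t t≺v)))))
        (far≥δ t∉)
      ...   | tri> _ _ t≺a | inj₂ u∈N | _ = antisym
        (≤-trans (d-swap≤ (proj₂ (≺-max u≺t t≺a))) (≤-reflexive (to-N a∈ u∈N
          (λ u∈β → t∉ (node-convex β⊑ ε u∈β a∈ u≺t t≺a)))))
        (far≥δ t∉)

    equidistant : ∀ {x t} → x ∈ˡ leaves β → t ∈ˡ forestLeaves βs → t ∉ˡ leaves β → d x t ≈ δ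
    equidistant x∈ t∈ t∉ = Eq.trans (d-swap≈ (β-mm t∉ x∈ a∈)) (equidistant-from-a t∈ t∉)

  equidistant⇒apex : ∀ {δ βs β} → node Q βs ⊑ T → β ∈ˡ βs →
    (∀ {x t} → x ∈ˡ leaves β → t ∈ˡ forestLeaves βs → t ∉ˡ leaves β → d x t ≈ δ) →
    IsApexChild D δ βs β
  equidistant⇒apex {β = β} p β∈ eq = β∈ , λ {γ} γ∈ γ≢β x∈ y∈ →
    eq (∈X⁻ {β} x∈) (child-leaf γ∈ (∈X⁻ {γ} y∈))
       (λ y∈β → γ≢β (children-disjoint (node-unique p) γ∈ β∈ (∈X⁻ {γ} y∈) y∈β))

  apex⇒equidistant : ∀ {δ βs β x t} → IsApexChild D δ βs β →
    x ∈ˡ leaves β → t ∈ˡ forestLeaves βs → t ∉ˡ leaves β → d x t ≈ δ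
  apex⇒equidistant {βs = βs} {β} (β∈ , apex) x∈ t∈ t∉ =
    let γ , γ∈ , t∈γ = childOf βs t∈
    in apex γ∈ (λ { refl → t∉ t∈γ }) (∈X⁺ {β} x∈) (∈X⁺ {γ} t∈γ)

  -- Under a P-node, `β` would be either connected or cut: the first contradicts the overlap, the
  -- second `P-uncut`.
  overlapped-child : ∀ {k βs β a b c} {N : Pred (Fin n) 0ℓ} → node k βs ⊑ T → β ∈ˡ βs →
    Decidable N → Mmodule N → a ∈ˡ leaves β → ¬ N a → b ∈ˡ leaves β → N b → N c →
    c ∉ˡ leaves β →
    k ≡ Q × ∃[ δ ] (IsApexChild D δ βs β × ¬ Connected D δ X⟨ β ⟩)
  overlapped-child {Q} p β∈ N? mm a∈ a∉N b∈ b∈N c∈N c∉ =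
    refl , δ , equidistant⇒apex p β∈ equidistant , disconnected
    where open Overlap p β∈ N? mm a∈ a∉N b∈ b∈N c∈N c∉
  overlapped-child {P} p β∈ N? mm a∈ a∉N b∈ b∈N c∈N c∉ =
    contradiction (node-path-or-cut δ β⊑ diameter≤δ)
      [ disconnected , P-uncut p β∈ equidistant ]′
    where open Overlap p β∈ N? mm a∈ a∉N b∈ b∈N c∈N c∉

  overlapped⇒split : ∀ {α a b c} {N : Pred (Fin n) 0ℓ} → α ⊑ T →
    Decidable N → Mmodule N → a ∈ˡ leaves α → ¬ N a → b ∈ˡ leaves α → N b → N c →
    c ∉ˡ leaves α → Split D T α
  overlapped⇒split p N? mm a∈ a∉N b∈ b∈N c∈N c∉ with parent p (leaves-full ε _) c∉
  ... | k , βs , q , α∈ with overlapped-child q α∈ N? mm a∈ a∉N b∈ b∈N c∈N c∉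
  ...   | refl , δ , apex , disconnected = δ , βs , q , apex , disconnected

  apex-diameter : ∀ {δ βs β x y} → node Q βs ⊑ T → IsApexChild D δ βs β →
                  x ∈ˡ leaves β → y ∈ˡ leaves β → d x y ≤ δ
  apex-diameter p apex@(β∈ , _) x∈ y∈ =
    let t , t∈ , t∉ = sibling (wellFormed-⊑ p wellFormed) (node-unique p) β∈
    in ≤-trans (node-diameter (child-⊑ p β∈) x∈ y∈ t∉)
               (≤-reflexive (apex⇒equidistant apex x∈ t∈ t∉))

  -- An apex child has diameter at most the `δ` of its parent, so `Q-connected` applies.
  Q-standard : ∀ {βs} → Standard D T (node Q βs)
  Q-standard (δ , γs , p , apex@(β∈ , _) , disconnected) =
    disconnected (Q-connected (child-⊑ p β∈) (apex-diameter p apex))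

  -- Mmodules meeting two children of a Q-node.

  first-leaf : ∀ {α x} → α ⊑ T → x ∈ˡ leaves α →
               ∃[ e ] (e ∈ˡ leaves α × (∀ {u} → u ∈ˡ leaves α → ¬ u ≺ e))
  first-leaf {α} p x∈ =
    let us , ws , eq = ⊑-infix p
        e , e∈ , least = go (leaves α) (node-unique p) x∈
    in e , e∈ , λ {u} u∈ u≺e → least
         (precedes-infix us (leaves α) ws (subst Unique eq (leaves-unique ε)) u∈ e∈
           (subst (λ l → Precedes l u e) eq u≺e))
    where
    go : ∀ xs {x : Fin n} → Unique xs → x ∈ˡ xs →
         ∃[ e ] (e ∈ˡ xs × (∀ {u} → ¬ Precedes xs u e))
    go (e ∷ xs) u _ = e , here refl ,
      λ { (_ ∷ʳ p)   → Unique[x∷xs]⇒x∉xs u (precedes-∈ʳ p)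
        ; (refl ∷ p) → Unique[x∷xs]⇒x∉xs u (to∈ p) }

  -- Both N and its complement in the Q-node α are mmodules.  If the
  -- complement were to meet two children, each of the two would surround every
  -- leaf of α outside of it, but neither surrounds the first leaf of α.
  module Surrounded {βs β p x y} {N : Pred (Fin n) 0ℓ}
    (α⊑ : node Q βs ⊑ T) (β∈ : β ∈ˡ βs) (p∈ : p ∈ˡ leaves β)
    (N? : Decidable N) (mm : Mmodule N) (p∉N : ¬ N p) (x∈N : N x) (y∈N : N y)
    (x∈ : x ∈ˡ forestLeaves βs) (xy : Apart βs x y) where

    δ : Carrier
    δ = d p x

    p∈α : p ∈ˡ forestLeaves βs
    p∈α = child-leaf β∈ p∈

    -- Otherwise `N` would overlap `α`, as `p` and `x` show, and a Q-node is never split.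
    N⊆α : ∀ {z} → N z → z ∈ˡ forestLeaves βs
    N⊆α {z} z∈N with z ∈ˡ? forestLeaves βs
    ... | yes z∈ = z∈
    ... | no z∉  =
      contradiction (overlapped⇒split α⊑ N? mm p∈α p∉N x∈ x∈N z∈N z∉) Q-standard

    straddled : ∀ {s} → s ∈ˡ forestLeaves βs → ¬ N s →
                (∃[ u ] (N u × u ≺ s)) × (∃[ v ] (N v × s ≺ v))
    straddled s∈ s∉N = [ (λ s∈N → contradiction s∈N s∉N) , id ]′
      (Hull.Q-straddled N? mm α⊑ x∈N y∈N x∈ (N⊆α y∈N) xy s∈)

    to-δ : ∀ {z} → N z → d p z ≈ δ
    to-δ z∈N = mm p∉N z∈N x∈N

    -- Points of `N` lie beyond `p` and beyond `k` on both sides. The one beyond `k` bounds the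
    -- distance from `k` to `N` above by `δ`, and the one beyond `p` bounds it below.
    equidistant-from-N : ∀ {k z} → k ∈ˡ forestLeaves βs → ¬ N k → N z → d k z ≈ δ
    equidistant-from-N {k} k∈ k∉N z∈N with compare p k | straddled p∈α p∉N | straddled k∈ k∉N
    ... | tri≈ _ refl _ | _ | _ = to-δ z∈N
    ... | tri< p≺k _ _ | (u , u∈N , u≺p) , _ | _ , (v , v∈N , k≺v) = antisym
      (≤-trans (≤-reflexive (mm k∉N z∈N v∈N))
        (≤-trans (proj₂ (≺-max p≺k k≺v)) (≤-reflexive (to-δ v∈N))))
      (≤-trans (≤-reflexive (Eq.sym (to-δ u∈N)))
        (≤-trans (d-swap≤ (proj₁ (≺-max u≺p p≺k))) (≤-reflexive (mm k∉N u∈N z∈N))))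
    ... | tri> _ _ k≺p | _ , (v , v∈N , p≺v) | (u , u∈N , u≺k) , _ = antisym
      (≤-trans (≤-reflexive (mm k∉N z∈N u∈N))
        (≤-trans (d-swap≤ (proj₁ (≺-max u≺k k≺p))) (≤-reflexive (to-δ u∈N))))
      (≤-trans (≤-reflexive (Eq.sym (to-δ v∈N)))
        (≤-trans (proj₂ (≺-max k≺p p≺v)) (≤-reflexive (mm k∉N v∈N z∈N))))

    C : Pred (Fin n) 0ℓ
    C k = k ∈ˡ forestLeaves βs × ¬ N k

    C? : Decidable C
    C? k = k ∈ˡ? forestLeaves βs ×-dec ¬? (N? k)

    C-mmodule : Mmodule C
    C-mmodule {z} z∉ (k∈ , k∉N) (l∈ , l∉N) with N? z
    ... | yes z∈N = d-swap≈ (Eq.trans (equidistant-from-N k∈ k∉N z∈N)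
                                      (Eq.sym (equidistant-from-N l∈ l∉N z∈N)))
    ... | no z∉N  = node-mmodule α⊑ (λ z∈ → z∉ (z∈ , z∉N)) k∈ l∈

    C⊆β : ∀ {t} → C t → t ∈ˡ leaves β
    C⊆β {t} t∈C@(t∈ , _) with t ∈ˡ? leaves β | first-leaf α⊑ p∈α
    ... | yes t∈β | _ = t∈β
    ... | no t∉β | e , e∈ , least
      with N? e | Hull.Q-straddled C? C-mmodule α⊑ (p∈α , p∉N) t∈C p∈α t∈
                    (∉⇒apart (node-unique α⊑) β∈ p∈ t∉β) e∈
    ... | no e∉N | _ =
      let (u , u∈N , u≺e) , _ = straddled e∈ e∉N in contradiction u≺e (least (N⊆α u∈N))
    ... | yes e∈N | inj₁ (_ , e∉N) = contradiction e∈N e∉N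
    ... | yes _   | inj₂ ((u , (u∈ , _) , u≺e) , _) = contradiction u≺e (least u∈)

    equidistant : ∀ {x t} → x ∈ˡ leaves β → t ∈ˡ forestLeaves βs → t ∉ˡ leaves β → d x t ≈ δ
    equidistant {t = t} x∈ t∈ t∉ with N? t
    ... | yes t∈N = Eq.trans (d-swap≈ (node-mmodule (child-⊑ α⊑ β∈) t∉ x∈ p∈)) (to-δ t∈N)
    ... | no t∉N  = contradiction (C⊆β (t∈ , t∉N)) t∉

    apex : IsApexChild D δ βs β
    apex = equidistant⇒apex α⊑ β∈ equidistant

  -- Split nodes and the children of P-nodes.

  same-parent : ∀ {k k′ βs βs′ β} → node k βs ⊑ T → β ∈ˡ βs → node k′ βs′ ⊑ T → β ∈ˡ βs′ →
                node k βs ≡ node k′ βs′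
  same-parent p β∈ q β∈′ =
    let _ , x∈ = someLeaf (wellFormed-⊑ (child-⊑ p β∈) wellFormed)
        _ , y∈ , y∉ = sibling (wellFormed-⊑ p wellFormed) (node-unique p) β∈
        _ , z∈ , z∉ = sibling (wellFormed-⊑ q wellFormed) (node-unique q) β∈′
    in parent-unique (leaves-unique ε) x∈ p β∈ y∈ y∉ q β∈′ z∈ z∉

  -- A split node has a Q-node as parent, and the parent is unique.
  P-child-standard : ∀ {βs β} → node P βs ⊑ T → β ∈ˡ βs → Standard D T β
  P-child-standard p β∈ (_ , _ , q , (β∈′ , _) , _) = case same-parent p β∈ q β∈′ of λ ()

  -- All distances between `γ` and the other children of a P-node are equal. Were they different
  -- from `δ`, the graph would contain every edge between `γ` and the rest, hence be connected.
  disconnected⇒equidistant : ∀ {δ γs γ z x} → node P γs ⊑ T → ¬ Connected D δ X⟨ node P γs ⟩ →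
    γ ∈ˡ γs → z ∈ˡ leaves γ → x ∈ˡ forestLeaves γs → x ∉ˡ leaves γ → d z x ≈ δ
  disconnected⇒equidistant {δ} {γs} {γ} {z} {x} p disconnected γ∈ z∈ x∈ x∉ with d z x ≈? δ
  ... | yes eq = eq
  ... | no ≉δ  = contradiction (λ {u} {v} u∈ v∈ → path (∈X⁻ {β} u∈) (∈X⁻ {β} v∈)) disconnected
    where
    β = node P γs

    join : ∀ {u v} → u ∈ˡ leaves γ → v ∈ˡ forestLeaves γs → v ∉ˡ leaves γ →
           Edge D δ X⟨ β ⟩ u v
    join u∈ v∈ v∉ = ∈X⁺ {β} (child-leaf γ∈ u∈) , ∈X⁺ {β} v∈ , (λ { refl → v∉ u∈ }) , λ eq →
      ≉δ (Eq.trans (d-swap≈ (node-mmodule (child-⊑ p γ∈) x∉ z∈ u∈))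
                   (Eq.trans (P-complement p γ∈ u∈ x∈ x∉ v∈ v∉) eq))

    join⁻¹ : ∀ {u v} → u ∈ˡ leaves γ → v ∈ˡ forestLeaves γs → v ∉ˡ leaves γ →
             Edge D δ X⟨ β ⟩ v u
    join⁻¹ u∈ v∈ v∉ =
      let u∈X , v∈X , u≢v , neq = join u∈ v∈ v∉
      in v∈X , u∈X , u≢v ∘ sym , neq ∘ Eq.trans (symmetric _ _)

    path : ∀ {u v} → u ∈ˡ forestLeaves γs → v ∈ˡ forestLeaves γs → Star (Edge D δ X⟨ β ⟩) u v
    path {u} {v} u∈ v∈ with u ∈ˡ? leaves γ | v ∈ˡ? leaves γ
    ... | yes u∈γ | yes v∈γ = join u∈γ x∈ x∉ ◅ join⁻¹ v∈γ x∈ x∉ ◅ ε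
    ... | yes u∈γ | no v∉γ  = join u∈γ v∈ v∉γ ◅ ε
    ... | no u∉γ  | yes v∈γ = join⁻¹ v∈γ u∈ u∉γ ◅ ε
    ... | no u∉γ  | no v∉γ  = join⁻¹ z∈ u∈ u∉γ ◅ join z∈ v∈ v∉γ ◅ ε

  -- The listed sets are copoints.

  ∈─⁺ : ∀ {α γ : PQTree (Fin n)} {x} → x ∈ˡ leaves α → x ∉ˡ leaves γ → x ∈ X⟨ α ⟩ ─ X⟨ γ ⟩
  ∈─⁺ {α} {γ} x∈ x∉ = x∈p∧x∉q⇒x∈p─q (∈X⁺ {α} x∈) (x∉ ∘ ∈X⁻ {γ})

  ∈─⁻ : ∀ {α γ : PQTree (Fin n)} {x} → x ∈ X⟨ α ⟩ ─ X⟨ γ ⟩ → x ∈ˡ leaves α × x ∉ˡ leaves γ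
  ∈─⁻ {α} {γ} x∈ =
    ∈X⁻ {α} (p─q⊆p X⟨ α ⟩ X⟨ γ ⟩ x∈) , λ x∈γ → x∈p─q⇒x∉q X⟨ α ⟩ X⟨ γ ⟩ x∈ (∈X⁺ {γ} x∈γ)

  complement-mmodule : ∀ {α γ} → α ⊑ T →
    (∀ {z x y} → z ∈ˡ leaves γ → x ∈ˡ leaves α → x ∉ˡ leaves γ → y ∈ˡ leaves α → y ∉ˡ leaves γ →
     d z x ≈ d z y) →
    IsMmodule D (X⟨ α ⟩ ─ X⟨ γ ⟩)
  complement-mmodule {α} {γ} α⊑ same {z} z∉ x∈L y∈L
    with ∈─⁻ {α} {γ} x∈L | ∈─⁻ {α} {γ} y∈L | z ∈ˡ? leaves γ
  ... | x∈ , x∉ | y∈ , y∉ | yes z∈γ = same z∈γ x∈ x∉ y∈ y∉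
  ... | x∈ , x∉ | y∈ , y∉ | no z∉γ  = node-mmodule α⊑ (λ z∈ → z∉ (∈─⁺ {α} {γ} z∈ z∉γ)) x∈ y∈

  -- The common criterion for the three families of differences. A larger mmodule avoiding `p` would
  -- contain a point of `γ`, and then overlap `γ`, or a point outside `α`, and then overlap `α`.
  -- Standard nodes are not overlapped.
  complement-copoint : ∀ {α γ p t} → α ⊑ T → γ ⊑ T → Standard D T α → Standard D T γ →
    p ∈ˡ leaves γ → p ∈ˡ leaves α → t ∈ˡ leaves α → t ∉ˡ leaves γ →
    (∀ {z x y} → z ∈ˡ leaves γ → x ∈ˡ leaves α → x ∉ˡ leaves γ → y ∈ˡ leaves α → y ∉ˡ leaves γ →
     d z x ≈ d z y) →
    IsCopoint D p (X⟨ α ⟩ ─ X⟨ γ ⟩)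
  complement-copoint {α} {γ} {p} {t} α⊑ γ⊑ α-standard γ-standard p∈γ p∈α t∈ t∉ same = record
    { mmodule  = complement-mmodule {α} {γ} α⊑ same
    ; nonempty = t , ∈─⁺ {α} {γ} t∈ t∉
    ; avoids   = λ p∈ → proj₂ (∈─⁻ {α} {γ} p∈) p∈γ
    ; maximal  = maximal
    }
    where
    maximal : ∀ {N} → IsMmodule D N → p ∉ N → X⟨ α ⟩ ─ X⟨ γ ⟩ ⊆ N → N ⊆ X⟨ α ⟩ ─ X⟨ γ ⟩
    maximal {N} mm p∉N L⊆N {y} y∈N with y ∈ˡ? leaves γ | y ∈ˡ? leaves α
    ... | yes y∈γ | _ = contradiction
      (overlapped⇒split γ⊑ (_∈? N) mm p∈γ p∉N y∈γ y∈N (L⊆N (∈─⁺ {α} {γ} t∈ t∉)) t∉) γ-standard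
    ... | no _    | no y∉α = contradiction
      (overlapped⇒split α⊑ (_∈? N) mm p∈α p∉N t∈ (L⊆N (∈─⁺ {α} {γ} t∈ t∉)) y∈N y∉α) α-standard
    ... | no y∉γ  | yes y∈α = ∈─⁺ {α} {γ} y∈α y∉γ

  apex-complement : ∀ {δ βs β z x y} → IsApexChild D δ βs β → z ∈ˡ leaves β →
    x ∈ˡ forestLeaves βs → x ∉ˡ leaves β → y ∈ˡ forestLeaves βs → y ∉ˡ leaves β → d z x ≈ d z y
  apex-complement apex z∈ x∈ x∉ y∈ y∉ =
    Eq.trans (apex⇒equidistant apex z∈ x∈ x∉) (Eq.sym (apex⇒equidistant apex z∈ y∈ y∉))

  P-copoint : ∀ {βs β p} → node P βs ⊑ T → Standard D T (node P βs) → β ∈ˡ βs →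
    p ∈ˡ leaves β → IsCopoint D p (X⟨ node P βs ⟩ ─ X⟨ β ⟩)
  P-copoint {βs} {β} α⊑ standard β∈ p∈ =
    let t , t∈ , t∉ = sibling (wellFormed-⊑ α⊑ wellFormed) (node-unique α⊑) β∈
    in complement-copoint {node P βs} {β} α⊑ (child-⊑ α⊑ β∈) standard (P-child-standard α⊑ β∈)
         p∈ (child-leaf β∈ p∈) t∈ t∉ (P-complement α⊑ β∈)

  -- A larger mmodule avoiding `p` has points both in `β` and outside it, which by `Surrounded`
  -- makes the child containing `p` an apex child.
  Q-copoint : ∀ {βs β p} → node Q βs ⊑ T → β ∈ˡ βs → p ∈ˡ forestLeaves βs → p ∉ˡ leaves β →
    (∀ δ γ → IsApexChild D δ βs γ → ¬ (p ∈ X⟨ γ ⟩)) → IsCopoint D p X⟨ β ⟩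
  Q-copoint {βs} {β} {p} α⊑ β∈ p∈ p∉ no-apex = record
    { mmodule  = λ z∉ x∈ y∈ →
        node-mmodule (child-⊑ α⊑ β∈) (z∉ ∘ ∈X⁺ {β}) (∈X⁻ {β} x∈) (∈X⁻ {β} y∈)
    ; nonempty = x , ∈X⁺ {β} x∈
    ; avoids   = p∉ ∘ ∈X⁻ {β}
    ; maximal  = maximal
    }
    where
    some = someLeaf (wellFormed-⊑ (child-⊑ α⊑ β∈) wellFormed)
    x    = proj₁ some
    x∈   = proj₂ some
    maximal : ∀ {N} → IsMmodule D N → p ∉ N → X⟨ β ⟩ ⊆ N → N ⊆ X⟨ β ⟩
    maximal {N} mm p∉N β⊆N {y} y∈N with y ∈ˡ? leaves β | childOf βs p∈
    ... | yes y∈β | _ = ∈X⁺ {β} y∈β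
    ... | no y∉β | γ , γ∈ , p∈γ = contradiction (∈X⁺ {γ} p∈γ) (no-apex δ γ apex)
      where open Surrounded α⊑ γ∈ p∈γ (_∈? N) mm p∉N (β⊆N (∈X⁺ {β} x∈)) y∈N (child-leaf β∈ x∈)
                             (∉⇒apart (node-unique α⊑) β∈ x∈ y∉β)

  apex-copoint : ∀ {δ βs β p} → node Q βs ⊑ T → IsApexChild D δ βs β → Standard D T β →
    p ∈ˡ leaves β → IsCopoint D p (X⟨ node Q βs ⟩ ─ X⟨ β ⟩)
  apex-copoint {δ} {βs} {β} α⊑ apex@(β∈ , _) standard p∈ =
    let t , t∈ , t∉ = sibling (wellFormed-⊑ α⊑ wellFormed) (node-unique α⊑) β∈
    in complement-copoint {node Q βs} {β} α⊑ (child-⊑ α⊑ β∈) Q-standard standard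
         p∈ (child-leaf β∈ p∈) t∈ t∉ (apex-complement apex)

  -- A split node is a P-node. Its child `γ` is at distance `δ` from its siblings because the split
  -- node is disconnected, and from the rest of the Q-node because the split node is the apex child.
  split-copoint : ∀ {βs k γs γ p} → node Q βs ⊑ T → node k γs ∈ˡ βs → Split D T (node k γs) →
    γ ∈ˡ γs → p ∈ˡ leaves γ → IsCopoint D p (X⟨ node Q βs ⟩ ─ X⟨ γ ⟩)
  split-copoint {k = Q} α⊑ η∈ split γ∈ p∈ = contradiction split Q-standard
  split-copoint {βs} {P} {γs} {γ} α⊑ η∈ (δ , βs′ , α⊑′ , apex@(η∈′ , _) , disconnected) γ∈ p∈
    -- This identifies the conical node recorded in the split witness with the given Q-node.
    with same-parent α⊑ η∈ α⊑′ η∈′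
  ... | refl =
    let η⊑ = child-⊑ α⊑ η∈
        t , t∈ , t∉ = sibling (wellFormed-⊑ η⊑ wellFormed) (node-unique η⊑) γ∈
    in complement-copoint {node Q βs} {γ} α⊑ (child-⊑ η⊑ γ∈) Q-standard (P-child-standard η⊑ γ∈)
         p∈ (child-leaf η∈ (child-leaf γ∈ p∈)) (child-leaf η∈ t∈) t∉
         (λ z∈ x∈ x∉ y∈ y∉ → Eq.trans (to-δ z∈ x∈ x∉) (Eq.sym (to-δ z∈ y∈ y∉)))
    where
    to-δ : ∀ {z x} → z ∈ˡ leaves γ → x ∈ˡ forestLeaves βs → x ∉ˡ leaves γ → d z x ≈ δ
    to-δ {x = x} z∈ x∈ x∉ with x ∈ˡ? forestLeaves γs
    ... | yes x∈η = disconnected⇒equidistant (child-⊑ α⊑ η∈) disconnected γ∈ z∈ x∈η x∉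
    ... | no x∉η  = apex⇒equidistant apex (child-leaf γ∈ z∈) x∈ x∉η

  -- Identifying a copoint from one of its points.

  -- The union with `M` is an mmodule avoiding `p`, so maximality absorbs it.
  mmodule⊆copoint : ∀ {p x M N} → IsCopoint D p M → IsMmodule D N → p ∉ N →
                    x ∈ M → x ∈ N → N ⊆ M
  mmodule⊆copoint {M = M} {N} copoint mm p∉N x∈M x∈N y∈N =
    maximal {M ∪ N}
      (λ z∉ x∈ y∈ → mmodule-∪ {_∈ M} {_∈ N} mmodule mm x∈M x∈N
        [ z∉ ∘ x∈p∪q⁺ ∘ inj₁ , z∉ ∘ x∈p∪q⁺ ∘ inj₂ ]′ (x∈p∪q⁻ M N x∈) (x∈p∪q⁻ M N y∈))
      ([ avoids , p∉N ]′ ∘ x∈p∪q⁻ M N) (x∈p∪q⁺ ∘ inj₁) (x∈p∪q⁺ (inj₂ y∈N))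
    where open IsCopoint copoint

  meeting-copoints-equal : ∀ {p x M N} → IsCopoint D p M → IsCopoint D p N →
                           x ∈ M → x ∈ N → M ≡ N
  meeting-copoints-equal cM cN x∈M x∈N = ⊆-antisym
    (mmodule⊆copoint cN (mmodule cM) (avoids cM) x∈N x∈M)
    (mmodule⊆copoint cM (mmodule cN) (avoids cN) x∈M x∈N)
    where open IsCopoint

  single-leaf-connected : ∀ {δ} (x : Fin n) → Connected D δ X⟨ leaf x ⟩
  single-leaf-connected x u∈ v∈ with ∈X⁻ {leaf x} u∈ | ∈X⁻ {leaf x} v∈
  ... | here refl | here refl = ε

  -- A split witness might name another constant `δ′`. Both constants are the distance from `β` to a
  -- leaf of a sibling, so they agree and the two graphs coincide.
  apex-connected⇒standard : ∀ {δ βs β} → node Q βs ⊑ T → IsApexChild D δ βs β →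
    Connected D δ X⟨ β ⟩ → Standard D T β
  apex-connected⇒standard {δ} {βs} {β} α⊑ apex@(β∈ , _) connected
    (δ′ , _ , α⊑′ , apex′@(β∈′ , _) , disconnected) with same-parent α⊑ β∈ α⊑′ β∈′
  ... | refl = disconnected (λ u∈ v∈ → Star.map
    (λ (u∈ , v∈ , u≢v , ≉δ) → u∈ , v∈ , u≢v , λ eq → ≉δ (Eq.trans eq δ′≈δ)) (connected u∈ v∈))
    where
    δ′≈δ : δ′ ≈ δ
    δ′≈δ =
      let _ , x∈ = someLeaf (wellFormed-⊑ (child-⊑ α⊑ β∈) wellFormed)
          _ , t∈ , t∉ = sibling (wellFormed-⊑ α⊑ wellFormed) (node-unique α⊑) β∈
      in Eq.trans (Eq.sym (apex⇒equidistant apex′ x∈ t∈ t∉)) (apex⇒equidistant apex x∈ t∈ t∉)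

  PListed QListed ApexListed SplitListed : Fin n → Subset n → Set (c ⊔ ℓ₁)
  PListed p M = ∃[ βs ] ∃[ β ]
    (Υ T p (node P βs) × Standard D T (node P βs) ×
     β ∈ˡ βs × Υ T p β ×
     M ≡ X⟨ node P βs ⟩ ─ X⟨ β ⟩)
  QListed p M = ∃[ βs ] ∃[ β ]
    (Υ T p (node Q βs) × β ∈ˡ βs × ¬ Υ T p β ×
     (∀ δ γ → IsApexChild D δ βs γ → ¬ (p ∈ X⟨ γ ⟩)) ×
     M ≡ X⟨ β ⟩)
  ApexListed p M = ∃[ δ ] ∃[ βs ] ∃[ β ]
    (Υ T p (node Q βs) × IsApexChild D δ βs β ×
     Standard D T β × Υ T p β × Connected D δ X⟨ β ⟩ ×
     M ≡ X⟨ node Q βs ⟩ ─ X⟨ β ⟩)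
  SplitListed p M = ∃[ δ ] ∃[ βs ] ∃[ η ] ∃[ k ] ∃[ γs ] ∃[ γ ]
    (Υ T p (node Q βs) × IsApexChild D δ βs η ×
     node k γs ∈ˡ βs × Split D T (node k γs) × Υ T p (node k γs) ×
     γ ∈ˡ γs × Υ T p γ ×
     M ≡ X⟨ node Q βs ⟩ ─ X⟨ γ ⟩)

  Listed : Fin n → Subset n → Set (c ⊔ ℓ₁)
  Listed p M = PListed p M ⊎ QListed p M ⊎ ApexListed p M ⊎ SplitListed p M

  ∈⇒Υ : ∀ {α p} → α ⊑ T → p ∈ˡ leaves α → Υ T p α
  ∈⇒Υ {α} α⊑ p∈ = α⊑ , ∈⇒leaf α p∈

  listed⇒copoint : ∀ {p M} → Listed p M → IsCopoint D p M
  listed⇒copoint (inj₁ (βs , β , (α⊑ , _) , standard , β∈ , (_ , p∈) , refl)) =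
    P-copoint α⊑ standard β∈ (leaf⇒∈ p∈)
  listed⇒copoint (inj₂ (inj₁ (βs , β , (α⊑ , p∈) , β∈ , ¬Υβ , no-apex , refl))) =
    Q-copoint α⊑ β∈ (leaf⇒∈ p∈) (¬Υβ ∘ ∈⇒Υ (child-⊑ α⊑ β∈)) no-apex
  listed⇒copoint (inj₂ (inj₂ (inj₁ (δ , βs , β , (α⊑ , _) , apex , standard , (_ , p∈) , _ , refl)))) =
    apex-copoint α⊑ apex standard (leaf⇒∈ p∈)
  listed⇒copoint (inj₂ (inj₂ (inj₂
    (δ , βs , _ , k , γs , γ , (α⊑ , _) , _ , η∈ , split , _ , γ∈ , (_ , p∈) , refl)))) =
    split-copoint α⊑ η∈ split γ∈ (leaf⇒∈ p∈)

  module _ {p M x} (copoint : IsCopoint D p M) (x∈M : x ∈ M) where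

    open IsCopoint copoint

    split-listed : ∀ {k γs γ} → Split D T (node k γs) → γ ∈ˡ γs → p ∈ˡ leaves γ →
                   x ∉ˡ leaves γ → x ∈ˡ forestLeaves γs → SplitListed p M
    split-listed {k} {γs} {γ} split@(δ , βs , α⊑ , apex@(η∈ , _) , _) γ∈ p∈ x∉ x∈ =
      δ , βs , _ , k , γs , γ , ∈⇒Υ α⊑ (child-leaf η∈ (child-leaf γ∈ p∈)) , apex , η∈ , split ,
      ∈⇒Υ η⊑ (child-leaf γ∈ p∈) , γ∈ , ∈⇒Υ (child-⊑ η⊑ γ∈) p∈ ,
      meeting-copoints-equal copoint (split-copoint α⊑ η∈ split γ∈ p∈) x∈M
        (∈─⁺ {node Q βs} {γ} (child-leaf η∈ x∈) x∉)
      where η⊑ = child-⊑ α⊑ η∈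

    -- The test is whether `M` leaves the P-node. If so, `M` overlaps it and it is split. If not, it
    -- is standard, for otherwise `M` would be the copoint of the conical parent, which contains a
    -- leaf outside the P-node.
    P-listed : ∀ {βs β} → node P βs ⊑ T → β ∈ˡ βs → p ∈ˡ leaves β → x ∈ˡ forestLeaves βs →
               x ∉ˡ leaves β → PListed p M ⊎ SplitListed p M
    P-listed {βs} {β} α⊑ β∈ p∈ x∈ x∉ with any? (λ y → y ∈? M ×-dec ¬? (y ∈ˡ? forestLeaves βs))
    ... | yes (y , y∈M , y∉α) = inj₂ (split-listed
      (overlapped⇒split α⊑ (_∈? M) mmodule (child-leaf β∈ p∈) avoids x∈ x∈M y∈M y∉α)
      β∈ p∈ x∉ x∈)
    ... | no M⊆α = inj₁ (βs , β , ∈⇒Υ α⊑ (child-leaf β∈ p∈) , standard , β∈ ,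
      ∈⇒Υ (child-⊑ α⊑ β∈) p∈ ,
      meeting-copoints-equal copoint (P-copoint α⊑ standard β∈ p∈) x∈M
        (∈─⁺ {node P βs} {β} x∈ x∉))
      where
      standard : Standard D T (node P βs)
      standard split@(_ , γs , α′⊑ , (α∈ , _) , _) =
        let _ , _ , _ , _ , _ , _ , _ , _ , _ , _ , _ , _ , _ , M≡ = split-listed split β∈ p∈ x∉ x∈
            t , t∈ , t∉ = sibling (wellFormed-⊑ α′⊑ wellFormed) (node-unique α′⊑) α∈
        in M⊆α (t , subst (t ∈_) (sym M≡)
             (∈─⁺ {node Q γs} {β} t∈ (t∉ ∘ child-leaf β∈)) , t∉)

    -- The diameter of an apex child is at most `δ`, so the alternative between a path and a cut
    -- decides its connectivity, and with it the choice between the third family and the fourth.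
    apex-listed : ∀ {δ βs β} → node Q βs ⊑ T → IsApexChild D δ βs β → p ∈ˡ leaves β →
                  x ∈ˡ forestLeaves βs → x ∉ˡ leaves β → ApexListed p M ⊎ SplitListed p M
    apex-listed {δ} {βs} {β} α⊑ apex@(β∈ , _) p∈ x∈ x∉
      with node-path-or-cut δ (child-⊑ α⊑ β∈) (apex-diameter α⊑ apex)
    ... | inj₁ connected = inj₁ (δ , βs , β , ∈⇒Υ α⊑ (child-leaf β∈ p∈) , apex , standard ,
      ∈⇒Υ (child-⊑ α⊑ β∈) p∈ , connected ,
      meeting-copoints-equal copoint (apex-copoint α⊑ apex standard p∈) x∈M
        (∈─⁺ {node Q βs} {β} x∈ x∉))
      where standard = apex-connected⇒standard α⊑ apex connected
    apex-listed {β = leaf y} α⊑ apex@(β∈ , _) p∈ x∈ x∉ | inj₂ cut =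
      ⊥-elim (cut⇒disconnected (child-⊑ α⊑ β∈) cut (single-leaf-connected y))
    apex-listed {δ} {βs} {node k γs} α⊑ apex@(β∈ , _) p∈ x∈ x∉ | inj₂ cut =
      let γ , γ∈ , p∈γ = childOf γs p∈
          split = δ , βs , α⊑ , apex , cut⇒disconnected (child-⊑ α⊑ β∈) cut
      in inj₂ (δ , βs , _ , k , γs , γ , ∈⇒Υ α⊑ (child-leaf β∈ p∈) , apex , β∈ , split ,
         ∈⇒Υ (child-⊑ α⊑ β∈) p∈ , γ∈ , ∈⇒Υ (child-⊑ (child-⊑ α⊑ β∈) γ∈) p∈γ ,
         meeting-copoints-equal copoint (split-copoint α⊑ β∈ split γ∈ p∈γ) x∈M
           (∈─⁺ {node Q βs} {γ} x∈ (x∉ ∘ child-leaf γ∈)))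

    -- The test is whether `M` stays in the child `γ` of `x`. If not, `M` meets two children while
    -- avoiding `p`, so the child of `p` is an apex child.
    Q-listed : ∀ {βs β} → node Q βs ⊑ T → β ∈ˡ βs → p ∈ˡ leaves β → x ∈ˡ forestLeaves βs →
               x ∉ˡ leaves β → QListed p M ⊎ ApexListed p M ⊎ SplitListed p M
    Q-listed {βs} {β} α⊑ β∈ p∈ x∈ x∉ with childOf βs x∈
    ... | γ , γ∈ , x∈γ with any? (λ y → y ∈? M ×-dec ¬? (y ∈ˡ? leaves γ))
    ...   | yes (y , y∈M , y∉γ) = inj₂ (apex-listed α⊑ apex p∈ x∈ x∉)
      where open Surrounded α⊑ β∈ p∈ (_∈? M) mmodule avoids x∈M y∈M x∈
                             (∉⇒apart (node-unique α⊑) γ∈ x∈γ y∉γ)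
    ...   | no M⊆γ = inj₁ (βs , γ , ∈⇒Υ α⊑ (child-leaf β∈ p∈) , γ∈ , p∉γ ∘ leaf⇒∈ ∘ proj₂ , no-apex ,
      meeting-copoints-equal copoint (Q-copoint α⊑ γ∈ (child-leaf β∈ p∈) p∉γ no-apex)
        x∈M (∈X⁺ {γ} x∈γ))
      where
      disjoint : ∀ {γ δ y} → γ ∈ˡ βs → δ ∈ˡ βs → y ∈ˡ leaves γ → y ∈ˡ leaves δ → γ ≡ δ
      disjoint = children-disjoint (node-unique α⊑)

      p∉γ : p ∉ˡ leaves γ
      p∉γ p∈γ with disjoint β∈ γ∈ p∈ p∈γ
      ... | refl = x∉ x∈γ

      -- If `β` were an apex child, its complement in the Q-node would be an mmodule through `x`
      -- avoiding `p`, hence contained in `M` and so in `γ`. Only the two children `β` and `γ` would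
      -- then have leaves, too few for a Q-node.
      no-apex : ∀ δ η → IsApexChild D δ βs η → ¬ (p ∈ X⟨ η ⟩)
      no-apex δ η apex@(η∈ , _) p∈η with disjoint β∈ η∈ p∈ (∈X⁻ {η} p∈η)
      ... | refl = case Q-pigeonhole {L = _∈ˡ leaves β} {R = _∈ˡ leaves γ}
        (wellFormed-⊑ α⊑ wellFormed) (node-unique α⊑) β-or-γ of λ where
          (_ , _ , _ , _ , yz , inj₁ (y∈ , z∈)) → yz β∈ y∈ z∈
          (_ , _ , _ , _ , yz , inj₂ (y∈ , z∈)) → yz γ∈ y∈ z∈
        where
        L⊆M : X⟨ node Q βs ⟩ ─ X⟨ β ⟩ ⊆ M
        L⊆M = mmodule⊆copoint copoint
          (complement-mmodule {node Q βs} {β} α⊑ (apex-complement apex))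
          (λ p∈L → proj₂ (∈─⁻ {node Q βs} {β} p∈L) p∈) x∈M (∈─⁺ {node Q βs} {β} x∈ x∉)

        β-or-γ : ∀ {y} → y ∈ˡ forestLeaves βs → y ∈ˡ leaves β ⊎ y ∈ˡ leaves γ
        β-or-γ {y} y∈ with y ∈ˡ? leaves β | y ∈ˡ? leaves γ
        ... | yes y∈β | _       = inj₁ y∈β
        ... | _       | yes y∈γ = inj₂ y∈γ
        ... | no y∉β  | no y∉γ  =
          contradiction (y , L⊆M (∈─⁺ {node Q βs} {β} y∈ y∉β) , y∉γ) M⊆γ

  copoint⇒listed : ∀ {p M} → IsCopoint D p M → Listed p M
  copoint⇒listed {p} {M} copoint with IsCopoint.nonempty copoint
  ... | x , x∈M with meet (∈⇒leaf T (leaves-full ε p)) (leaves-full ε x)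
                       (λ { refl → IsCopoint.avoids copoint x∈M })
  ...   | Q , _ , _ , α⊑ , β∈ , p∈ , x∈ , x∉ = inj₂ (Q-listed copoint x∈M α⊑ β∈ p∈ x∈ x∉)
  ...   | P , _ , _ , α⊑ , β∈ , p∈ , x∈ , x∉ =
    map₂ (inj₂ ∘ inj₂) (P-listed copoint x∈M α⊑ β∈ p∈ x∈ x∉)

theorem7p5 : ∀ {c ℓ₁ ℓ₂} (V : DecTotalOrder c ℓ₁ ℓ₂) (0# : DecTotalOrder.Carrier V)
    (n : ℕ) (D : Dissimilarity V 0# n) →
    Robinson D →
    (T : PQTree (Fin n)) → IsPQTree T → RepresentsCompatibleOrders D T →
    (p : Fin n) (M : Subset n) →
    IsCopoint D p M ⇔
    ( (∃[ βs ] ∃[ β ]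
    (Υ T p (node P βs) × Standard D T (node P βs) ×
    β ∈ˡ βs × Υ T p β ×
    M ≡ X⟨ node P βs ⟩ ─ X⟨ β ⟩))
    ⊎ (∃[ βs ] ∃[ β ]
    (Υ T p (node Q βs) × β ∈ˡ βs × ¬ Υ T p β ×
    (∀ δ γ → IsApexChild D δ βs γ → ¬ (p ∈ X⟨ γ ⟩)) ×
    M ≡ X⟨ β ⟩))
    ⊎ (∃[ δ ] ∃[ βs ] ∃[ β ]
    (Υ T p (node Q βs) × IsApexChild D δ βs β ×
    Standard D T β × Υ T p β × Connected D δ X⟨ β ⟩ ×
    M ≡ X⟨ node Q βs ⟩ ─ X⟨ β ⟩))
    ⊎ (∃[ δ ] ∃[ βs ] ∃[ η ] ∃[ k ] ∃[ γs ] ∃[ γ ]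
    (Υ T p (node Q βs) × IsApexChild D δ βs η ×
    node k γs ∈ˡ βs × Split D T (node k γs) × Υ T p (node k γs) ×
    γ ∈ˡ γs × Υ T p γ ×
    M ≡ X⟨ node Q βs ⟩ ─ X⟨ γ ⟩)))
theorem7p5 V 0# n D _ T isPQTree represents p M = mk⇔ copoint⇒listed listed⇒copoint
  where open PQTreeOf D T isPQTree represents
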